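{- The following decision problem is undecidable: given a universal Horn sentence $\Phi$ over a finite relational signature $\tau$, decide whether the class $\mathrm{Mod}(\Phi)$ of all finite models of $\Phi$ has the joint embedding property. The problem remains undecidable even when every relation symbol in $\tau$ has arity at most two.
   Context: Formulas are first-order over a finite relational signature $\tau$ and do not use equality atoms (atomic formulas are only of the form $R(x_1,\dots,x_n)$ with $R\in\tau$). A universal sentence is Horn if its quantifier-free part is a conjunction of Horn clauses, i.e., disjunctions of atomic and negated atomic formulas with at most one positive disjunct. $\mathrm{Mod}(\Phi)$ denotes the class of all finite $\tau$-structures satisfying $\Phi$. A class $\mathcal{C}$ of $\tau$-structures has the joint embedding property (JEP) if for all $\mathfrak{B}_1,\mathfrak{B}_2\in\mathcal{C}$ there is $\mathfrak{C}\in\mathcal{C}$ with embeddings $\mathfrak{B}_1\hookrightarrow\mathfrak{C}$ and $\mathfrak{B}_2\hookrightarrow\mathfrak{C}$. -}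

module Defs where

open import Data.Bool.Base using (Bool; true; false)
open import Data.Fin.Base using (Fin; zero; suc; toℕ)
open import Data.List.Base using (List; []; _∷_; filterᵇ; length; tabulate)
open import Data.List.Relation.Unary.All using (All)
open import Data.List.Relation.Unary.Any using (Any)
open import Data.Nat.Base using (ℕ; zero; suc; _≤_; _<_)
open import Data.Product.Base using (∃-syntax; _×_)
open import Data.Vec.Base as Vec using (Vec)
open import Function.Definitions using (Injective)
open import Level using (0ℓ)
open import Relation.Binary.PropositionalEquality using (_≡_)
open import Relation.Nullary.Negation using (¬_)
open import Relation.Unary using (Pred)

record Signature : Set where
  field
    symbols  : ℕ
    arity    : Fin symbols → ℕ
    positive : ∀ R → 0 < arity R

open Signature public

-- The empty structure is admitted.  It embeds into every structure, as there
-- are no nullary symbols, so excluding it would not affect which classes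
-- Mod Φ have the joint embedding property.
record Structure (τ : Signature) : Set where
  field
    size : ℕ
    rel  : (R : Fin (symbols τ)) → Vec (Fin size) (arity τ R) → Bool

open Structure public

record _↪_ {τ : Signature} (𝔄 𝔅 : Structure τ) : Set where
  field
    map       : Fin (size 𝔄) → Fin (size 𝔅)
    injective : Injective _≡_ _≡_ map
    strong    : ∀ R xs → rel 𝔅 R (Vec.map map xs) ≡ rel 𝔄 R xs

JEP : {τ : Signature} → Pred (Structure τ) 0ℓ → Set
JEP 𝒞 = ∀ 𝔅₁ 𝔅₂ → 𝒞 𝔅₁ → 𝒞 𝔅₂ → ∃[ ℭ ] (𝒞 ℭ × (𝔅₁ ↪ ℭ) × (𝔅₂ ↪ ℭ))

record Atom (τ : Signature) (k : ℕ) : Set where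
  constructor atom
  field
    symbol    : Fin (symbols τ)
    arguments : Vec (Fin k) (arity τ symbol)

data Literal (τ : Signature) (k : ℕ) : Set where
  pos neg : Atom τ k → Literal τ k

Clause : Signature → ℕ → Set
Clause τ k = List (Literal τ k)

isPositive : ∀ {τ k} → Literal τ k → Bool
isPositive (pos _) = true
isPositive (neg _) = false

IsHorn : ∀ {τ k} → Clause τ k → Set
IsHorn c = length (filterᵇ isPositive c) ≤ 1

-- The sentence ∀ x₀ … x₍ₖ₋₁₎. ⋀ clauses, with k = variables, where each clause
-- is the disjunction of its literals.
record HornSentence : Set where
  field
    signature : Signature
    variables : ℕ
    clauses   : List (Clause signature variables)
    horn      : All IsHorn clauses

open HornSentence public

module _ {τ : Signature} (𝔅 : Structure τ) {k : ℕ} (v : Fin k → Fin (size 𝔅)) where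

  HoldsAtom : Atom τ k → Set
  HoldsAtom (atom R xs) = rel 𝔅 R (Vec.map v xs) ≡ true

  HoldsLiteral : Literal τ k → Set
  HoldsLiteral (pos a) = HoldsAtom a
  HoldsLiteral (neg a) = ¬ HoldsAtom a

Mod : (Φ : HornSentence) → Pred (Structure (signature Φ)) 0ℓ
Mod Φ 𝔅 = ∀ v → All (Any (HoldsLiteral 𝔅 v)) (clauses Φ)

HasJEP : HornSentence → Set
HasJEP Φ = JEP (Mod Φ)

ArityAtMost : ℕ → HornSentence → Set
ArityAtMost m Φ = ∀ R → arity (signature Φ) R ≤ m

-- The model of computation is the untyped λ-calculus, with closed terms
-- evaluated by weak call-by-value reduction (no reduction under binders); it
-- is Turing-complete on Scott-encoded data.

data Λ (n : ℕ) : Set where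
  var : Fin n → Λ n
  lam : Λ (suc n) → Λ n
  app : Λ n → Λ n → Λ n

extʳ : ∀ {m n} → (Fin m → Fin n) → Fin (suc m) → Fin (suc n)
extʳ ρ zero    = zero
extʳ ρ (suc i) = suc (ρ i)

rename : ∀ {m n} → (Fin m → Fin n) → Λ m → Λ n
rename ρ (var i)   = var (ρ i)
rename ρ (lam t)   = lam (rename (extʳ ρ) t)
rename ρ (app s t) = app (rename ρ s) (rename ρ t)

extˢ : ∀ {m n} → (Fin m → Λ n) → Fin (suc m) → Λ (suc n)
extˢ σ zero    = var zero
extˢ σ (suc i) = rename suc (σ i)

subst : ∀ {m n} → (Fin m → Λ n) → Λ m → Λ n
subst σ (var i)   = σ i
subst σ (lam t)   = lam (subst (extˢ σ) t)
subst σ (app s t) = app (subst σ s) (subst σ t)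

single : ∀ {n} → Λ n → Fin (suc n) → Λ n
single t zero    = t
single t (suc i) = var i

_[_] : ∀ {n} → Λ (suc n) → Λ n → Λ n
s [ t ] = subst (single t) s

infix 4 _⇓_

data _⇓_ : Λ 0 → Λ 0 → Set where
  lam⇓ : ∀ {s} → lam s ⇓ lam s
  app⇓ : ∀ {s s′ t u v} → s ⇓ lam s′ → t ⇓ u → s′ [ u ] ⇓ v → app s t ⇓ v

-- Data are represented by their Scott encodings, which are closed normal
-- abstractions; the index n only allows them to be used under binders.

encodeBool : ∀ {n} → Bool → Λ n
encodeBool true  = lam (lam (var (suc zero)))
encodeBool false = lam (lam (var zero))

encodeℕ : ∀ {n} → ℕ → Λ n
encodeℕ zero    = lam (lam (var (suc zero)))
encodeℕ (suc k) = lam (lam (app (var zero) (encodeℕ k)))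

encodePair : ∀ {n} → Λ (suc n) → Λ (suc n) → Λ n
encodePair s t = lam (app (app (var zero) s) t)

encodeList : {A : Set} → (∀ {n} → A → Λ n) → ∀ {n} → List A → Λ n
encodeList enc []       = lam (lam (var (suc zero)))
encodeList enc (x ∷ xs) = lam (lam (app (app (var zero) (enc x)) (encodeList enc xs)))

encodeAtom : ∀ {τ k n} → Atom τ k → Λ n
encodeAtom (atom R xs) =
  encodePair (encodeℕ (toℕ R)) (encodeList (λ i → encodeℕ (toℕ i)) (Vec.toList xs))

encodeLiteral : ∀ {τ k n} → Literal τ k → Λ n
encodeLiteral (pos a) = encodePair (encodeBool true)  (encodeAtom a)
encodeLiteral (neg a) = encodePair (encodeBool false) (encodeAtom a)

-- A sentence is given to a program as its list of arities, its number of
-- variables, and its list of clauses.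
encodeSentence : ∀ {n} → HornSentence → Λ n
encodeSentence Φ =
  encodePair (encodeList encodeℕ (tabulate (arity (signature Φ))))
    (encodePair (encodeℕ (variables Φ))
      (encodeList (encodeList encodeLiteral) (clauses Φ)))

-- The behaviour of the program is constrained only on the codes of instances.
Decides : {A : Set} → (A → Λ 0) → Pred A 0ℓ → Λ 0 → Set
Decides {A} encode P t = (a : A) →
  (P a → app t (encode a) ⇓ encodeBool true) ×
  (¬ P a → app t (encode a) ⇓ encodeBool false)

Undecidable : {A : Set} → (A → Λ 0) → Pred A 0ℓ → Set
Undecidable encode P = ¬ (∃[ t ] Decides encode P t)

{-# OPTIONS --safe #-}
module Submission where

-- A union of two models of a Horn sentence without equality can only fail to
-- extend to a model without changing the two parts if a derivation crosses
-- from one part to the other.  The sentence Φ bs makes such a derivation run a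
-- deterministic machine: a configuration is a binary tree, a node x of one
-- model stands for a tree, and stateˢ(x , κ) says that the tree of x is
-- reached, where κ is an element of the other model marked as a key.  One
-- model supplies the key and the other all the trees of an accepting run, so
-- the two have no joint extension if the machine accepts.  If it halts without
-- accepting, then the finitely many configurations of its run give the values
-- of stateˢ across the union.
--
-- The machine first reads a postfix program bs, building a λ-term together
-- with the code of bs, and then evaluates the term on this code.  Given a
-- decider t, choose for bs the term that computes the code of Φ bs from the
-- code of bs, runs t on it, and is accepted exactly if t answers true.

open import Defs
open import Data.Product.Base using (Σ; _×_; proj₁)
open import Data.Bool.Base using (Bool; true; false)
import Data.Bool.Properties as Bool
open import Data.Empty using (⊥; ⊥-elim)
open import Data.Fin.Base using (Fin; zero; suc; toℕ; splitAt; _↑ˡ_; _↑ʳ_)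
open import Data.Fin.Patterns
import Data.Fin.Properties as Fin
open import Data.List.Base as List
  using (List; []; _∷_; _++_; concatMap; length; lookup; deduplicate; tabulate; cartesianProductWith)
open import Data.List.Membership.Propositional using (_∈_; find; lose)
import Data.List.Membership.Propositional.Properties as Membership
open import Data.List.Relation.Unary.All as All using (All; []; _∷_)
import Data.List.Relation.Unary.All.Properties as All
open import Data.List.Relation.Unary.Any as Any using (Any; here; there; index)
open import Data.List.Relation.Unary.Any.Properties using (lookup-index)
open import Data.Maybe.Base using (Maybe; just; nothing)
open import Data.Nat.Base using (ℕ; zero; suc; _+_; _∸_; _⊔_; _≤_; _<_; s≤s; z≤n)
import Data.Nat.Properties as ℕ
open import Data.Product.Base using (∃-syntax; Σ-syntax; _,_; proj₂)
open import Data.Sum.Base using (_⊎_; inj₁; inj₂; [_,_]′)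
open import Data.Unit using (⊤)
open import Data.Vec.Base as Vec using (Vec; []; _∷_)
open import Function.Base using (_∘_; case_of_)
open import Relation.Binary.Construct.Closure.ReflexiveTransitive using (Star; ε; _◅_; _◅◅_)
open import Relation.Binary.Definitions using (DecidableEquality)
open import Relation.Binary.PropositionalEquality as ≡
  using (_≡_; _≢_; refl; sym; trans; cong; cong₂)
open import Relation.Nullary.Decidable
  using (Dec; yes; no; does; map′; _×-dec_; _⊎-dec_; from-yes; dec-true; decidable-stable)
open import Relation.Nullary.Negation using (¬_)

-- A universal clause creates no elements, so a transition can fire only where the trees before and
-- after it are both present; the model of trees therefore contains all trees up to a depth that
-- covers the given finite run. This model alone has to satisfy the sentence, which is why
-- reachability is relative to a key that it lacks. For the positive case the obstacle is that both
-- models are arbitrary: nodes may have several children, lie on cycles or denote nothing. Without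
-- equality atoms children can be made unique only up to a preorder, and an element may even denote
-- several trees. It suffices that a pattern found by following edges from an element never clashes
-- with a tree that the element denotes. Hence the rules are designed so that any two left sides
-- differ at a position that edges can reach. Acceptance means that the value is the identity
-- function, because every closure of the identity can be recognized from its body alone.

private variable
  m n o : ℕ
  A B V W : Set

-- Weak call-by-value evaluation with closures

rename-rename : {ρ : Fin m → Fin n} {ρ′ : Fin n → Fin o} {ξ : Fin m → Fin o} →
  (∀ i → ρ′ (ρ i) ≡ ξ i) → ∀ t → rename ρ′ (rename ρ t) ≡ rename ξ t
rename-rename h (var i)   = cong var (h i)
rename-rename h (lam t)   =
  cong lam (rename-rename (λ { zero → refl ; (suc i) → cong suc (h i) }) t)
rename-rename h (app s t) = cong₂ app (rename-rename h s) (rename-rename h t)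

subst-rename : {ρ : Fin m → Fin n} {σ : Fin n → Λ o} {τ : Fin m → Λ o} →
  (∀ i → σ (ρ i) ≡ τ i) → ∀ t → subst σ (rename ρ t) ≡ subst τ t
subst-rename h (var i)   = h i
subst-rename h (lam t)   =
  cong lam (subst-rename (λ { zero → refl ; (suc i) → cong (rename suc) (h i) }) t)
subst-rename h (app s t) = cong₂ app (subst-rename h s) (subst-rename h t)

rename-suc-comm : (ρ : Fin m → Fin n) (t : Λ m) →
  rename (extʳ ρ) (rename suc t) ≡ rename suc (rename ρ t)
rename-suc-comm ρ t =
  trans (rename-rename (λ _ → refl) t) (sym (rename-rename (λ _ → refl) t))

rename-subst : {σ : Fin m → Λ n} {ρ : Fin n → Fin o} {τ : Fin m → Λ o} →
  (∀ i → rename ρ (σ i) ≡ τ i) → ∀ t → rename ρ (subst σ t) ≡ subst τ t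
rename-subst h (var i)   = h i
rename-subst {σ = σ} {ρ} h (lam t)   =
  cong lam (rename-subst
    (λ { zero → refl ; (suc i) → trans (rename-suc-comm ρ (σ i)) (cong (rename suc) (h i)) }) t)
rename-subst h (app s t) = cong₂ app (rename-subst h s) (rename-subst h t)

subst-suc-comm : (σ : Fin m → Λ n) (t : Λ m) →
  subst (extˢ σ) (rename suc t) ≡ rename suc (subst σ t)
subst-suc-comm σ t =
  trans (subst-rename (λ _ → refl) t) (sym (rename-subst (λ _ → refl) t))

subst-subst : {σ : Fin m → Λ n} {τ : Fin n → Λ o} {υ : Fin m → Λ o} →
  (∀ i → subst τ (σ i) ≡ υ i) → ∀ t → subst τ (subst σ t) ≡ subst υ t
subst-subst h (var i)   = h i
subst-subst {σ = σ} {τ} h (lam t)   =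
  cong lam (subst-subst
    (λ { zero → refl ; (suc i) → trans (subst-suc-comm τ (σ i)) (cong (rename suc) (h i)) }) t)
subst-subst h (app s t) = cong₂ app (subst-subst h s) (subst-subst h t)

subst-id : {σ : Fin n → Λ n} → (∀ i → σ i ≡ var i) → ∀ t → subst σ t ≡ t
subst-id h (var i)   = h i
subst-id h (lam t)   =
  cong lam (subst-id (λ { zero → refl ; (suc i) → cong (rename suc) (h i) }) t)
subst-id h (app s t) = cong₂ app (subst-id h s) (subst-id h t)

rename-as-subst : {ρ : Fin m → Fin n} {σ : Fin m → Λ n} →
  (∀ i → σ i ≡ var (ρ i)) → ∀ t → rename ρ t ≡ subst σ t
rename-as-subst h (var i)   = sym (h i)
rename-as-subst h (lam t)   =
  cong lam (rename-as-subst (λ { zero → refl ; (suc i) → cong (rename suc) (h i) }) t)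
rename-as-subst h (app s t) = cong₂ app (rename-as-subst h s) (rename-as-subst h t)

infixr 5 _∷_
infix 4 _⊢_⇓_

mutual
  data Closure : Set where
    closure : Λ (suc n) → Env n → Closure

  data Env : ℕ → Set where
    []  : Env 0
    _∷_ : Closure → Env n → Env (suc n)

infixl 9 _‼_

_‼_ : Env n → Fin n → Closure
(c ∷ _) ‼ zero  = c
(_ ∷ ρ) ‼ suc i = ρ ‼ i

-- Substitution acts at unbounded depth in a term. With environments in its place, each machine step
-- inspects and builds patterns of bounded size, which a single Horn clause can express.
data _⊢_⇓_ (ρ : Env n) : Λ n → Closure → Set where
  var⇓ : ∀ {i} → ρ ⊢ var i ⇓ ρ ‼ i
  lam⇓ : ∀ {s} → ρ ⊢ lam s ⇓ closure s ρ
  app⇓ : ∀ {s t} {s′ : Λ (suc m)} {ρ′ c d} →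
    ρ ⊢ s ⇓ closure s′ ρ′ → ρ ⊢ t ⇓ c → c ∷ ρ′ ⊢ s′ ⇓ d → ρ ⊢ app s t ⇓ d

mutual
  readback : Closure → Λ 0
  readback (closure s ρ) = lam (subst (extˢ (readbackᴱ ρ)) s)

  readbackᴱ : Env n → Fin n → Λ 0
  readbackᴱ (c ∷ ρ) zero    = readback c
  readbackᴱ (c ∷ ρ) (suc i) = readbackᴱ ρ i

readbackᴱ-‼ : (ρ : Env n) (i : Fin n) → readbackᴱ ρ i ≡ readback (ρ ‼ i)
readbackᴱ-‼ (c ∷ ρ) zero    = refl
readbackᴱ-‼ (c ∷ ρ) (suc i) = readbackᴱ-‼ ρ i

readback-β : (s : Λ (suc n)) (ρ : Env n) (c : Closure) →
  subst (extˢ (readbackᴱ ρ)) s [ readback c ] ≡ subst (readbackᴱ (c ∷ ρ)) s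
readback-β s ρ c = subst-subst
  (λ { zero    → refl
     ; (suc i) → trans (subst-rename (λ _ → refl) (readbackᴱ ρ i))
                       (subst-id (λ ()) (readbackᴱ ρ i)) }) s

-- Induction on the derivation, with its subject given only up to an equation because bodies of
-- closures occur as substitution instances. A variable stands for a closure, whose readback is an
-- abstraction and thus its own value.
simulate : ∀ {w v} → w ⇓ v → (t : Λ n) (ρ : Env n) → w ≡ subst (readbackᴱ ρ) t →
  ∃[ c ] (ρ ⊢ t ⇓ c × readback c ≡ v)
simulate w⇓v (var i) ρ eq = ρ ‼ i , var⇓ , value w⇓v (ρ ‼ i) (trans eq (readbackᴱ-‼ ρ i))
  where
  value : ∀ {w v} → w ⇓ v → ∀ c → w ≡ readback c → readback c ≡ v
  value lam⇓          c             eq = sym eq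
  value (app⇓ _ _ _)  (closure _ _) ()
simulate lam⇓ (lam t) ρ eq = closure t ρ , lam⇓ , sym eq
simulate (app⇓ f⇓ a⇓ b⇓) (app f a) ρ refl
  with simulate f⇓ f ρ refl | simulate a⇓ a ρ refl
... | closure s′ ρ′ , f⇓′ , refl | c , a⇓′ , refl
  with simulate b⇓ s′ (c ∷ ρ′) (readback-β s′ ρ′ c)
... | d , b⇓′ , eq = d , app⇓ f⇓′ a⇓′ b⇓′ , eq

simulate-β : ∀ {f′ : Λ (suc n)} {ρ : Env n} {s v} (a : Closure) →
  readback (closure f′ ρ) ≡ lam s → s [ readback a ] ⇓ v →
  ∃[ c ] (a ∷ ρ ⊢ f′ ⇓ c × readback c ≡ v)
simulate-β {f′ = f′} {ρ} a refl d = simulate d f′ (a ∷ ρ) (readback-β f′ ρ a)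

-- A rewriting machine on binary trees

infixr 5 _∙_

data Tree (V : Set) : Set where
  meta : V → Tree V
  leaf : Tree V
  _∙_  : Tree V → Tree V → Tree V

Ground Pattern : Set
Ground  = Tree ⊥
Pattern = Tree ℕ

inst : (V → Tree W) → Tree V → Tree W
inst θ (meta i) = θ i
inst θ leaf     = leaf
inst θ (a ∙ b)  = inst θ a ∙ inst θ b

numeral : ℕ → Tree V
numeral zero    = leaf
numeral (suc n) = leaf ∙ numeral n

varᵗ lamᵗ : Tree V → Tree V
varᵗ i = numeral 0 ∙ i
lamᵗ t = numeral 1 ∙ t

appᵗ : Tree V → Tree V → Tree V
appᵗ s t = numeral 2 ∙ s ∙ t

⌜_⌝ : Λ n → Tree V
⌜ var i ⌝   = varᵗ (numeral (toℕ i))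
⌜ lam t ⌝   = lamᵗ ⌜ t ⌝
⌜ app s t ⌝ = appᵗ ⌜ s ⌝ ⌜ t ⌝

mutual
  ⌜_⌝ᶜ : Closure → Tree V
  ⌜ closure s ρ ⌝ᶜ = ⌜ s ⌝ ∙ ⌜ ρ ⌝ᴱ

  ⌜_⌝ᴱ : Env n → Tree V
  ⌜ [] ⌝ᴱ    = leaf
  ⌜ c ∷ ρ ⌝ᴱ = ⌜ c ⌝ᶜ ∙ ⌜ ρ ⌝ᴱ

-- A token is an instruction of a postfix program building a λ-term on a stack:
-- push var 0, increment the variable on top, abstract, apply.
Token : Set
Token = Fin 4

encodeTokens : List Token → Λ n
encodeTokens = encodeList (λ b → encodeℕ (toℕ b))

-- The code of a Scott cons cell as a function of the code of its tail, so that a rule can prepend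
-- one token to a code held in a metavariable.
consCode : ℕ → Tree V → Tree V
consCode b A = lamᵗ (lamᵗ (appᵗ (appᵗ (varᵗ leaf) ⌜ encodeℕ {0} b ⌝) A))

code : List Token → Tree V
code []       = ⌜ encodeTokens {0} [] ⌝
code (b ∷ bs) = consCode (toℕ b) (code bs)

⌜encodeℕ⌝ : ∀ k → _≡_ {A = Tree V} ⌜ encodeℕ {m} k ⌝ ⌜ encodeℕ {n} k ⌝
⌜encodeℕ⌝ zero    = refl
⌜encodeℕ⌝ (suc k) = cong (λ t → lamᵗ (lamᵗ (appᵗ (varᵗ leaf) t))) (⌜encodeℕ⌝ k)

code-correct : ∀ bs → _≡_ {A = Tree V} (code bs) ⌜ encodeTokens {n} bs ⌝
code-correct []       = refl
code-correct (b ∷ bs) = cong₂ (λ x xs → lamᵗ (lamᵗ (appᵗ (appᵗ (varᵗ leaf) x) xs)))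
                          (⌜encodeℕ⌝ (toℕ b)) (code-correct bs)

evaluating reading : Tree V → Tree V → Tree V → Tree V
evaluating t ρ K   = numeral 0 ∙ t ∙ ρ ∙ K
reading    ts st A = numeral 2 ∙ ts ∙ st ∙ A

returning argument : Tree V → Tree V → Tree V
returning c K  = numeral 1 ∙ c ∙ K
argument  t ρ  = numeral 0 ∙ t ∙ ρ

-- A `starting` tree has a leaf on the right, where every other configuration has a node; this
-- separates it from them without a tag.
function starting : Tree V → Tree V
function c  = numeral 1 ∙ c
starting ts = ts ∙ leaf

record Rule : Set where
  constructor _⟶_
  field
    lhs rhs : Pattern

open Rule public

infix 4 _⟶_

-- meta 0 is reserved for the key of the Horn clauses below.
rules : Vec Rule 12
rules =
    (starting v₁ ⟶ reading v₁ leaf (code []))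
  ∷ (reading (numeral 0 ∙ v₁) v₂ v₃ ⟶ reading v₁ (varᵗ leaf ∙ v₂) (consCode 0 v₃))
  ∷ (reading (numeral 1 ∙ v₁) (varᵗ v₂ ∙ v₃) v₄ ⟶ reading v₁ (varᵗ (leaf ∙ v₂) ∙ v₃) (consCode 1 v₄))
  ∷ (reading (numeral 2 ∙ v₁) (v₂ ∙ v₃) v₄ ⟶ reading v₁ (lamᵗ v₂ ∙ v₃) (consCode 2 v₄))
  ∷ (reading (numeral 3 ∙ v₁) (v₂ ∙ v₃ ∙ v₄) v₅ ⟶ reading v₁ (appᵗ v₃ v₂ ∙ v₄) (consCode 3 v₅))
  ∷ (reading leaf (v₁ ∙ leaf) v₂ ⟶ evaluating (appᵗ v₁ v₂) leaf leaf)
  ∷ (evaluating (varᵗ leaf) (v₁ ∙ v₂) v₃ ⟶ returning v₁ v₃)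
  ∷ (evaluating (varᵗ (leaf ∙ v₁)) (v₂ ∙ v₃) v₄ ⟶ evaluating (varᵗ v₁) v₃ v₄)
  ∷ (evaluating (lamᵗ v₁) v₂ v₃ ⟶ returning (v₁ ∙ v₂) v₃)
  ∷ (evaluating (appᵗ v₁ v₂) v₃ v₄ ⟶ evaluating v₁ v₃ (argument v₂ v₃ ∙ v₄))
  ∷ (returning v₁ (argument v₂ v₃ ∙ v₄) ⟶ evaluating v₂ v₃ (function v₁ ∙ v₄))
  ∷ (returning v₁ (function (v₂ ∙ v₃) ∙ v₄) ⟶ evaluating v₂ (v₁ ∙ v₃) v₄)
  ∷ []
  where
  v₁ v₂ v₃ v₄ v₅ : Pattern
  v₁ = meta 1
  v₂ = meta 2
  v₃ = meta 3
  v₄ = meta 4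
  v₅ = meta 5

opaque
  rule : Fin 12 → Rule
  rule = Vec.lookup rules

-- The accepted values are the closures with body `var 0`, that is, the identity function in some
-- environment.
accepting halted : Pattern
accepting = returning (varᵗ leaf ∙ meta 1) leaf
halted    = returning (meta 1) leaf

data Step : Ground → Ground → Set where
  step : ∀ r θ → Step (inst θ (lhs (rule r))) (inst θ (rhs (rule r)))

Run : Ground → Ground → Set
Run = Star Step

bind : List Ground → ℕ → Ground
bind (a ∷ _)  1             = a
bind (_ ∷ as) (suc (suc i)) = bind as (suc i)
bind _        _             = leaf

tokensVar : ℕ → List Token → List Token
tokensVar zero    bs = 0F ∷ bs
tokensVar (suc i) bs = 1F ∷ tokensVar i bs

-- The tokens of a term in reverse order, in front of bs.
tokens : Λ n → List Token → List Token
tokens (var i)   bs = tokensVar (toℕ i) bs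
tokens (lam t)   bs = 2F ∷ tokens t bs
tokens (app s t) bs = 3F ∷ tokens t (tokens s bs)

-- Consing onto an accumulator reverses the list, so the head of the list is read last. The part
-- already read is thus always a suffix, whose code is extended at the front.
chain : List Token → Tree V → Tree V
chain []       T = T
chain (b ∷ bs) T = chain bs (numeral (toℕ b) ∙ T)

postfixVar : ℕ → Tree V → Tree V
postfixVar zero    T = numeral 0 ∙ T
postfixVar (suc i) T = postfixVar i (numeral 1 ∙ T)

postfix : Λ n → Tree V → Tree V
postfix (var i)   T = postfixVar (toℕ i) T
postfix (lam t)   T = postfix t (numeral 2 ∙ T)
postfix (app s t) T = postfix s (postfix t (numeral 3 ∙ T))

chain-tokensVar : ∀ i bs (T : Tree V) → chain (tokensVar i bs) T ≡ chain bs (postfixVar i T)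
chain-tokensVar zero    bs T = refl
chain-tokensVar (suc i) bs T = chain-tokensVar i bs (numeral 1 ∙ T)

chain-tokens : ∀ (t : Λ n) bs (T : Tree V) → chain (tokens t bs) T ≡ chain bs (postfix t T)
chain-tokens (var i)   bs T = chain-tokensVar (toℕ i) bs T
chain-tokens (lam t)   bs T = chain-tokens t bs (numeral 2 ∙ T)
chain-tokens (app s t) bs T =
  trans (chain-tokens t (tokens s bs) (numeral 3 ∙ T)) (chain-tokens s bs (postfix t (numeral 3 ∙ T)))

opaque
  unfolding rule

  run-readVar : ∀ i bs T st →
    Run (reading (postfixVar i T) st (code bs))
        (reading T (varᵗ (numeral i) ∙ st) (code (tokensVar i bs)))
  run-readVar zero    bs T st = step 1F (bind (T ∷ st ∷ code bs ∷ [])) ◅ ε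
  run-readVar (suc i) bs T st = run-readVar i bs (numeral 1 ∙ T) st ◅◅
    step 2F (bind (T ∷ numeral i ∷ st ∷ code (tokensVar i bs) ∷ [])) ◅ ε

  run-read : ∀ (t : Λ n) bs T st →
    Run (reading (postfix t T) st (code bs)) (reading T (⌜ t ⌝ ∙ st) (code (tokens t bs)))
  run-read (var i)   bs T st = run-readVar (toℕ i) bs T st
  run-read (lam t)   bs T st = run-read t bs _ st ◅◅
    step 3F (bind (T ∷ ⌜ t ⌝ ∷ st ∷ code (tokens t bs) ∷ [])) ◅ ε
  run-read (app s t) bs T st = run-read s bs _ st ◅◅ run-read t (tokens s bs) _ _ ◅◅
    step 4F (bind (T ∷ ⌜ t ⌝ ∷ ⌜ s ⌝ ∷ st ∷ code (tokens t (tokens s bs)) ∷ [])) ◅ ε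

  run-var : ∀ (ρ : Env n) i K →
    Run (evaluating (varᵗ (numeral (toℕ i))) ⌜ ρ ⌝ᴱ K) (returning ⌜ ρ ‼ i ⌝ᶜ K)
  run-var (c ∷ ρ) zero    K = step 6F (bind (⌜ c ⌝ᶜ ∷ ⌜ ρ ⌝ᴱ ∷ K ∷ [])) ◅ ε
  run-var (c ∷ ρ) (suc i) K =
    step 7F (bind (numeral (toℕ i) ∷ ⌜ c ⌝ᶜ ∷ ⌜ ρ ⌝ᴱ ∷ K ∷ [])) ◅ run-var ρ i K

  run-eval : ∀ {ρ : Env n} {t c} → ρ ⊢ t ⇓ c → ∀ K →
    Run (evaluating ⌜ t ⌝ ⌜ ρ ⌝ᴱ K) (returning ⌜ c ⌝ᶜ K)
  run-eval {ρ = ρ} {var i} var⇓ K = run-var ρ i K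
  run-eval {ρ = ρ} {lam s} lam⇓ K = step 8F (bind (⌜ s ⌝ ∷ ⌜ ρ ⌝ᴱ ∷ K ∷ [])) ◅ ε
  run-eval {ρ = ρ} {app s t} (app⇓ {s′ = s′} {ρ′} {c} s⇓ t⇓ b⇓) K =
    step 9F (bind (⌜ s ⌝ ∷ ⌜ t ⌝ ∷ ⌜ ρ ⌝ᴱ ∷ K ∷ [])) ◅
    (run-eval s⇓ _ ◅◅
     step (Fin.suc 9F) (bind (⌜ closure s′ ρ′ ⌝ᶜ ∷ ⌜ t ⌝ ∷ ⌜ ρ ⌝ᴱ ∷ K ∷ [])) ◅
     (run-eval t⇓ _ ◅◅
      step (Fin.suc (Fin.suc 9F)) (bind (⌜ c ⌝ᶜ ∷ ⌜ s′ ⌝ ∷ ⌜ ρ′ ⌝ᴱ ∷ K ∷ [])) ◅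
      run-eval b⇓ K))

initial : List Token → Tree V
initial bs = starting (chain bs leaf)

opaque
  unfolding rule

  run-program : ∀ (t : Λ 0) {c} → [] ⊢ app t (encodeTokens (tokens t [])) ⇓ c →
    Run (initial (tokens t [])) (returning ⌜ c ⌝ᶜ leaf)
  run-program t {c} t⇓
    rewrite chain-tokens {V = ⊥} t [] leaf =
    step 0F (bind (postfix t leaf ∷ [])) ◅
    (run-read t [] leaf leaf ◅◅
     step 5F (bind (⌜ t ⌝ ∷ code (tokens t []) ∷ [])) ◅ start)
    where
    start : Run (evaluating (appᵗ ⌜ t ⌝ (code (tokens t []))) leaf leaf) (returning ⌜ c ⌝ᶜ leaf)
    start rewrite code-correct {V = ⊥} {n = 0} (tokens t []) = run-eval t⇓ leaf

-- Clashes between patterns and decidable properties of the rules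

∙-injective : {a b c d : Tree V} → a ∙ b ≡ c ∙ d → a ≡ c × b ≡ d
∙-injective refl = refl , refl

≟-tree : DecidableEquality V → DecidableEquality (Tree V)
≟-tree _≟_ (meta i) (meta j) = map′ (cong meta) (λ { refl → refl }) (i ≟ j)
≟-tree _≟_ leaf     leaf     = yes refl
≟-tree _≟_ (a ∙ b)  (c ∙ d)  = map′ (λ { (refl , refl) → refl }) ∙-injective
                                 (≟-tree _≟_ a c ×-dec ≟-tree _≟_ b d)
≟-tree _≟_ (meta _) leaf     = no λ ()
≟-tree _≟_ (meta _) (_ ∙ _)  = no λ ()
≟-tree _≟_ leaf     (meta _) = no λ ()
≟-tree _≟_ leaf     (_ ∙ _)  = no λ ()
≟-tree _≟_ (_ ∙ _)  (meta _) = no λ ()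
≟-tree _≟_ (_ ∙ _)  leaf     = no λ ()

-- A path at whose end one pattern has a leaf and the other a node. Unlike a mere inequality of
-- instances, it can be traced along left and right edges in an arbitrary model, down to a
-- configuration that the clauses forbid.
data Clash : Pattern → Pattern → Set where
  leaf-node : ∀ {a b} → Clash leaf (a ∙ b)
  node-leaf : ∀ {a b} → Clash (a ∙ b) leaf
  left      : ∀ {a b c d} → Clash a c → Clash (a ∙ b) (c ∙ d)
  right     : ∀ {a b c d} → Clash b d → Clash (a ∙ b) (c ∙ d)

clash? : ∀ p q → Dec (Clash p q)
clash? leaf     (_ ∙ _)  = yes leaf-node
clash? (_ ∙ _)  leaf     = yes node-leaf
clash? (a ∙ b)  (c ∙ d)  = map′ (λ { (inj₁ h) → left h ; (inj₂ h) → right h })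
                             (λ { (left h) → inj₁ h ; (right h) → inj₂ h })
                             (clash? a c ⊎-dec clash? b d)
clash? (meta _) _        = no λ ()
clash? leaf     (meta _) = no λ ()
clash? leaf     leaf     = no λ ()
clash? (_ ∙ _)  (meta _) = no λ ()

Occurs : ℕ → Pattern → Set
Occurs i (meta j) = i ≡ j
Occurs i leaf     = ⊥
Occurs i (a ∙ b)  = Occurs i a ⊎ Occurs i b

occurs? : ∀ i p → Dec (Occurs i p)
occurs? i (meta j) = i ℕ.≟ j
occurs? i leaf     = no λ ()
occurs? i (a ∙ b)  = occurs? i a ⊎-dec occurs? i b

VarsIn : Pattern → Pattern → Set
VarsIn p (meta i) = Occurs i p
VarsIn p leaf     = ⊤
VarsIn p (a ∙ b)  = VarsIn p a × VarsIn p b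

varsIn? : ∀ p q → Dec (VarsIn p q)
varsIn? p (meta i) = occurs? i p
varsIn? p leaf     = yes _
varsIn? p (a ∙ b)  = varsIn? p a ×-dec varsIn? p b

opaque
  unfolding rule

  rules-deterministic : ∀ r r′ → r ≡ r′ ⊎ Clash (lhs (rule r)) (lhs (rule r′))
  rules-deterministic = from-yes (Fin.all? λ r → Fin.all? λ r′ →
    (r Fin.≟ r′) ⊎-dec clash? (lhs (rule r)) (lhs (rule r′)))

  rules-varsIn : ∀ r → VarsIn (lhs (rule r)) (rhs (rule r))
  rules-varsIn = from-yes (Fin.all? λ r → varsIn? (lhs (rule r)) (rhs (rule r)))

  lhs-not-halted : ∀ r → Clash (lhs (rule r)) halted
  lhs-not-halted = from-yes (Fin.all? λ r → clash? (lhs (rule r)) halted)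

  lhs-not-accepting : ∀ r → Clash accepting (lhs (rule r))
  lhs-not-accepting = from-yes (Fin.all? λ r → clash? accepting (lhs (rule r)))

-- The Horn sentence of a program

pattern leafˢ  = zero
pattern keyˢ   = suc zero
pattern leftˢ  = suc (suc zero)
pattern rightˢ = suc (suc (suc zero))
pattern eqˢ    = suc (suc (suc (suc zero)))
pattern stateˢ = suc (suc (suc (suc (suc zero))))
pattern sameˢ  = suc (suc (suc (suc (suc (suc zero)))))

-- The unary predicates leafˢ and keyˢ are read on the diagonal.
τ : Signature
τ = record { symbols = 7 ; arity = λ _ → 2 ; positive = λ _ → s≤s z≤n }

infix 6 _⟨_,_⟩

record Fact : Set where
  constructor _⟨_,_⟩
  field
    symbol       : Fin 7
    first second : ℕ

open Fact public

infix 4 _⇒_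

record Implication : Set where
  constructor _⇒_
  field
    body : List Fact
    head : Maybe Fact

open Implication public

module _ (𝔅 : Structure τ) (w : ℕ → Fin (size 𝔅)) where

  Holds : Fact → Set
  Holds f = rel 𝔅 (symbol f) (w (first f) ∷ w (second f) ∷ []) ≡ true

  HoldsHead : Maybe Fact → Set
  HoldsHead (just f) = Holds f
  HoldsHead nothing  = ⊥

  Satisfies : Implication → Set
  Satisfies c = All Holds (body c) → HoldsHead (head c)

Satisfied : Structure τ → Implication → Set
Satisfied 𝔅 c = ∀ w → Satisfies 𝔅 w c

conclusion : Maybe Fact → List (Bool × Fact)
conclusion (just f) = (true , f) ∷ []
conclusion nothing  = []

signed : Implication → List (Bool × Fact)
signed (b ⇒ h) = List.map (false ,_) b ++ conclusion h

Within : ℕ → Fact → Set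
Within k f = first f ≤ k × second f ≤ k

-- `fin k` merges the variables from `k` on; within this bound it is injective, so that `literals`
-- says the same as the implication.
record Bounded (k : ℕ) (c : Implication) : Set where
  constructor bounded
  field
    body≤ : All (Within k) (body c)
    head≤ : ∀ {f} → head c ≡ just f → Within k f

-- Numbers above k are sent to k.
fin : ∀ k → ℕ → Fin (suc k)
fin k       zero    = zero
fin zero    (suc i) = zero
fin (suc k) (suc i) = suc (fin k i)

toℕ-fin : ∀ {k i} → i ≤ k → toℕ (fin k i) ≡ i
toℕ-fin z≤n     = refl
toℕ-fin (s≤s h) = cong suc (toℕ-fin h)

literalAt : ∀ k → Bool × Fact → Literal τ (suc k)
literalAt k (false , s ⟨ i , j ⟩) = neg (atom s (fin k i ∷ fin k j ∷ []))
literalAt k (true  , s ⟨ i , j ⟩) = pos (atom s (fin k i ∷ fin k j ∷ []))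

literals : ∀ k → Implication → Clause τ (suc k)
literals k c = List.map (literalAt k) (signed c)

literals-horn : ∀ k c → IsHorn (literals k c)
literals-horn k ([] ⇒ just f)   = s≤s z≤n
literals-horn k ([] ⇒ nothing)  = z≤n
literals-horn k ((_ ∷ b) ⇒ h) = literals-horn k (b ⇒ h)

sentence : ℕ → List Implication → HornSentence
sentence k cs = record
  { signature = τ
  ; variables = suc k
  ; clauses   = List.map (literals k) cs
  ; horn      = All.map⁺ (All.tabulate λ {c} _ → literals-horn k c)
  }

module _ (𝔅 : Structure τ) where

  satisfies⇒any : ∀ {k} (v : Fin (suc k) → Fin (size 𝔅)) b h → Satisfies 𝔅 (v ∘ fin k) (b ⇒ h) →
    Any (HoldsLiteral 𝔅 v) (literals k (b ⇒ h))
  satisfies⇒any v [] (just f) sat = here (sat [])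
  satisfies⇒any v [] nothing  sat = ⊥-elim (sat [])
  satisfies⇒any {k} v (f ∷ b) h sat
    with rel 𝔅 (symbol f) (v (fin k (first f)) ∷ v (fin k (second f)) ∷ []) Bool.≟ true
  ... | yes f✓ = there (satisfies⇒any v b h (λ hs → sat (f✓ ∷ hs)))
  ... | no  f✗ = here f✗

  module _ (w : ℕ → Fin (size 𝔅)) where

    holds-fin : ∀ {k} f → Within k f →
      rel 𝔅 (symbol f) (w (toℕ (fin k (first f))) ∷ w (toℕ (fin k (second f))) ∷ []) ≡
      rel 𝔅 (symbol f) (w (first f) ∷ w (second f) ∷ [])
    holds-fin f (h₁ , h₂) =
      cong₂ (λ i j → rel 𝔅 (symbol f) (w i ∷ w j ∷ [])) (toℕ-fin h₁) (toℕ-fin h₂)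

    any⇒satisfies : ∀ {k} b h → Bounded k (b ⇒ h) →
      Any (HoldsLiteral 𝔅 {suc k} (w ∘ toℕ)) (literals k (b ⇒ h)) → Satisfies 𝔅 w (b ⇒ h)
    any⇒satisfies [] (just f) (bounded [] h≤) (here f✓) [] = trans (sym (holds-fin f (h≤ refl))) f✓
    any⇒satisfies (f ∷ b) h (bounded (f≤ ∷ _) _) (here f✗) (f✓ ∷ _) =
      ⊥-elim (f✗ (trans (holds-fin f f≤) f✓))
    any⇒satisfies (f ∷ b) h (bounded (_ ∷ b≤) h≤) (there p) (_ ∷ hs) =
      any⇒satisfies b h (bounded b≤ h≤) p hs

  satisfied⇒mod : ∀ k cs → All (Satisfied 𝔅) cs → Mod (sentence k cs) 𝔅
  satisfied⇒mod k cs sat v =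
    All.map⁺ (All.map (λ {c} h → satisfies⇒any v (body c) (head c) (h (v ∘ fin _))) sat)

  mod⇒satisfied : ∀ k cs {c} → Mod (sentence k cs) 𝔅 → c ∈ cs → Bounded k c → Satisfied 𝔅 c
  mod⇒satisfied k cs {c} 𝔐 c∈cs bd w =
    any⇒satisfies w (body c) (head c) bd (All.lookup (All.map⁻ (𝔐 (w ∘ toℕ))) c∈cs)

subpatterns : Pattern → List Pattern
subpatterns (meta i) = meta i ∷ []
subpatterns leaf     = leaf ∷ []
subpatterns (a ∙ b)  = (a ∙ b) ∷ subpatterns a ++ subpatterns b

-- The variables of the clauses are the patterns in this list.  The tokens
-- come first, so that the variable for a token is the token itself.
opaque
  names : List Pattern
  names = deduplicate (≟-tree ℕ._≟_)
    (numeral 0 ∷ numeral 1 ∷ numeral 2 ∷ numeral 3 ∷ meta 0 ∷ meta 1 ∷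
     concatMap subpatterns (accepting ∷ tabulate (lhs ∘ rule) ++ tabulate (rhs ∘ rule)))

position : List Pattern → Pattern → ℕ
position []       p = 0
position (q ∷ qs) p with ≟-tree ℕ._≟_ q p
... | yes _ = 0
... | no  _ = suc (position qs p)

name : Pattern → ℕ
name = position names

-- A pattern missing from `names` is sent to `length names`. Starting the variables of the initial
-- chain one above this keeps them apart from every value of `name`.
key root base : ℕ
key  = name (meta 0)
root = name (meta 1)
base = suc (length names)

patternAt : List Pattern → ℕ → Pattern
patternAt []       _       = leaf
patternAt (q ∷ qs) zero    = q
patternAt (q ∷ qs) (suc i) = patternAt qs i

position≤length : ∀ qs p → position qs p ≤ length qs
position≤length []       p = z≤n
position≤length (q ∷ qs) p with ≟-tree ℕ._≟_ q p
... | yes _ = z≤n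
... | no  _ = s≤s (position≤length qs p)

name<base : ∀ p → name p < base
name<base p = s≤s (position≤length names p)

name≤base : ∀ p → name p ≤ base
name≤base p = ℕ.<⇒≤ (name<base p)

-- There are no clauses for sameˢ: it holds throughout the two models built
-- from an accepting run, and nowhere between the two parts of a union, so that
-- it confines the variables of a clause to one part.
guard : ℕ → Fact → List Fact
guard r f = sameˢ ⟨ r , first f ⟩ ∷ sameˢ ⟨ r , second f ⟩ ∷ f ∷ []

guarded : ℕ → List Fact → List Fact
guarded r = concatMap (guard r)

unguarded : ∀ {r} {P : Fact → Set} fs → All P (guarded r fs) → All P fs
unguarded []       []               = []
unguarded (f ∷ fs) (_ ∷ _ ∷ h ∷ hs) = h ∷ unguarded fs hs

-- The variable `y` of the head gets a guard of its own. The premise `f` has none: it alone may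
-- mention the key, which may lie in the other part.
keyed : ℕ → ℕ → List Fact → Fact → Maybe Fact → Implication
keyed r y fs f h = guarded r fs ++ sameˢ ⟨ r , y ⟩ ∷ f ∷ [] ⇒ h

shape : Pattern → List Fact
shape (meta i) = []
shape leaf     = leafˢ ⟨ name leaf , name leaf ⟩ ∷ []
shape (a ∙ b)  =
  leftˢ ⟨ name (a ∙ b) , name a ⟩ ∷ rightˢ ⟨ name (a ∙ b) , name b ⟩ ∷ shape a ++ shape b

reachable : ℕ → Fact
reachable i = stateˢ ⟨ i , key ⟩

-- The shapes of both sides are in the body, since the clause cannot create the nodes of the new
-- configuration. Metavariables common to both sides share a variable through `name`.
transition : Rule → Implication
transition (p ⟶ q) =
  keyed (name p) (name q) (shape p ++ shape q) (reachable (name p)) (just (reachable (name q)))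

-- Children are unique up to the preorder eqˢ, the substitute for equality.
structural : List Implication
structural =
    ([] ⇒ just (eqˢ ⟨ 0 , 0 ⟩))
  ∷ (eqˢ ⟨ 0 , 1 ⟩ ∷ eqˢ ⟨ 1 , 2 ⟩ ∷ [] ⇒ just (eqˢ ⟨ 0 , 2 ⟩))
  ∷ (eqˢ ⟨ 0 , 1 ⟩ ∷ leftˢ ⟨ 0 , 2 ⟩ ∷ leftˢ ⟨ 1 , 3 ⟩ ∷ [] ⇒ just (eqˢ ⟨ 2 , 3 ⟩))
  ∷ (eqˢ ⟨ 0 , 1 ⟩ ∷ rightˢ ⟨ 0 , 2 ⟩ ∷ rightˢ ⟨ 1 , 3 ⟩ ∷ [] ⇒ just (eqˢ ⟨ 2 , 3 ⟩))
  ∷ (eqˢ ⟨ 0 , 1 ⟩ ∷ leafˢ ⟨ 0 , 0 ⟩ ∷ leftˢ ⟨ 1 , 2 ⟩ ∷ [] ⇒ nothing)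
  ∷ (eqˢ ⟨ 0 , 1 ⟩ ∷ leafˢ ⟨ 1 , 1 ⟩ ∷ leftˢ ⟨ 0 , 2 ⟩ ∷ [] ⇒ nothing)
  ∷ []

acceptance : Implication
acceptance =
  keyed (name accepting) (name accepting) (shape accepting) (reachable (name accepting)) nothing

fixed : List Implication
fixed = acceptance ∷ tabulate (transition ∘ rule) ++ structural

-- Variable `i` is the chain built so far, variable `0` is the leaf, and each token is its own
-- variable. New facts go in front of the old ones, so that a λ-term can produce the clause in one
-- pass over the tokens.
initialFacts : ℕ → List Fact → List Token → List Fact
initialFacts i fs []       = leftˢ ⟨ root , i ⟩ ∷ rightˢ ⟨ root , 0 ⟩ ∷ fs
initialFacts i fs (b ∷ bs) =
  initialFacts (suc i) (leftˢ ⟨ suc i , toℕ b ⟩ ∷ rightˢ ⟨ suc i , i ⟩ ∷ fs) bs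

tokenFacts : List Fact
tokenFacts = leafˢ ⟨ base , base ⟩ ∷ shape (numeral 3)

starts : List Fact → Implication
starts fs = keyed 0 root fs (keyˢ ⟨ key , key ⟩) (just (reachable root))

top : ℕ → List Token → ℕ
top i []       = i
top i (b ∷ bs) = top (suc i) bs

implications : List Token → List Implication
implications bs = starts (initialFacts base tokenFacts bs) ∷ fixed

Φ : List Token → HornSentence
Φ bs = sentence (top base bs) (implications bs)

opaque
  unfolding names

  3<base : 3 < base
  3<base = ℕ.m≤m+n 4 _

-- Range and naming of the variables

guarded-within : ∀ {k r fs} → r ≤ k → All (Within k) fs → All (Within k) (guarded r fs)
guarded-within r≤k []             = []
guarded-within r≤k ((h , h′) ∷ hs) =
  (r≤k , h) ∷ (r≤k , h′) ∷ (h , h′) ∷ guarded-within r≤k hs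

keyed-bounded : ∀ {k r y fs f h} → r ≤ k → y ≤ k → All (Within k) fs → Within k f →
  (∀ {f} → h ≡ just f → Within k f) → Bounded k (keyed r y fs f h)
keyed-bounded r≤k y≤k fs≤k f≤k h≤k =
  bounded (All.++⁺ (guarded-within r≤k fs≤k) ((r≤k , y≤k) ∷ f≤k ∷ [])) h≤k

shape-within : ∀ {k} → base ≤ k → ∀ p → All (Within k) (shape p)
shape-within b≤k (meta i) = []
shape-within b≤k leaf     = (below , below) ∷ []
  where below = ℕ.≤-trans (name≤base leaf) b≤k
shape-within b≤k (a ∙ b)  =
  (below (a ∙ b) , below a) ∷ (below (a ∙ b) , below b) ∷
  All.++⁺ (shape-within b≤k a) (shape-within b≤k b)
  where below = λ p → ℕ.≤-trans (name≤base p) b≤k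

fixed-bounded : ∀ {k} → base ≤ k → All (Bounded k) fixed
fixed-bounded {k} b≤k =
  keyed-bounded (below accepting) (below accepting) (shape-within b≤k accepting)
    (below accepting , below (meta 0)) (λ ()) ∷
  All.++⁺ (All.tabulate⁺ λ r → transition-bounded (rule r)) structural-bounded
  where
  below : ∀ p → name p ≤ k
  below p = ℕ.≤-trans (name≤base p) b≤k
  transition-bounded : ∀ r → Bounded k (transition r)
  transition-bounded (p ⟶ q) = keyed-bounded (below p) (below q)
    (All.++⁺ (shape-within b≤k p) (shape-within b≤k q)) (below p , below (meta 0))
    λ { refl → below q , below (meta 0) }
  0≤ : 0 ≤ k
  0≤ = z≤n
  3≤ : 3 ≤ k
  3≤ = ℕ.≤-trans (ℕ.<⇒≤ 3<base) b≤k
  1≤ : 1 ≤ k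
  1≤ = ℕ.≤-trans (ℕ.m≤m+n 1 _) 3≤
  2≤ : 2 ≤ k
  2≤ = ℕ.≤-trans (ℕ.m≤m+n 2 _) 3≤
  structural-bounded : All (Bounded k) structural
  structural-bounded =
    bounded [] (λ { refl → 0≤ , 0≤ }) ∷
    bounded ((0≤ , 1≤) ∷ (1≤ , 2≤) ∷ []) (λ { refl → 0≤ , 2≤ }) ∷
    bounded ((0≤ , 1≤) ∷ (0≤ , 2≤) ∷ (1≤ , 3≤) ∷ []) (λ { refl → 2≤ , 3≤ }) ∷
    bounded ((0≤ , 1≤) ∷ (0≤ , 2≤) ∷ (1≤ , 3≤) ∷ []) (λ { refl → 2≤ , 3≤ }) ∷
    bounded ((0≤ , 1≤) ∷ (0≤ , 0≤) ∷ (1≤ , 2≤) ∷ []) (λ ()) ∷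
    bounded ((0≤ , 1≤) ∷ (1≤ , 1≤) ∷ (0≤ , 2≤) ∷ []) (λ ()) ∷
    []

top-≥ : ∀ i bs → i ≤ top i bs
top-≥ i []       = ℕ.≤-refl
top-≥ i (b ∷ bs) = ℕ.≤-trans (ℕ.n≤1+n i) (top-≥ (suc i) bs)

initialFacts-within : ∀ {k} i {fs} bs → base ≤ i → top i bs ≤ k → All (Within k) fs →
  All (Within k) (initialFacts i fs bs)
initialFacts-within i []       b≤i i≤k hs =
  (root≤k , i≤k) ∷ (root≤k , z≤n) ∷ hs
  where root≤k = ℕ.≤-trans (name≤base (meta 1)) (ℕ.≤-trans b≤i i≤k)
initialFacts-within {k} i (b ∷ bs) b≤i top≤k hs =
  initialFacts-within (suc i) bs (ℕ.m≤n⇒m≤1+n b≤i) top≤k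
    ((si≤k , b≤k) ∷ (si≤k , i≤k) ∷ hs)
  where
  si≤k : suc i ≤ k
  si≤k = ℕ.≤-trans (top-≥ (suc i) bs) top≤k
  i≤k : i ≤ k
  i≤k = ℕ.<⇒≤ si≤k
  b≤k : toℕ b ≤ k
  b≤k = ℕ.≤-trans (ℕ.<⇒≤ (Fin.toℕ<n b)) (ℕ.≤-trans 3<base (ℕ.≤-trans b≤i i≤k))

starts-bounded : ∀ bs → Bounded (top base bs) (starts (initialFacts base tokenFacts bs))
starts-bounded bs = keyed-bounded z≤n (below (meta 1))
  (initialFacts-within base bs ℕ.≤-refl ℕ.≤-refl
    ((top-≥ base bs , top-≥ base bs) ∷ shape-within (top-≥ base bs) (numeral 3)))
  (below (meta 0) , below (meta 0)) λ { refl → below (meta 1) , below (meta 0) }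
  where
  below : ∀ p → name p ≤ top base bs
  below p = ℕ.≤-trans (name≤base p) (top-≥ base bs)

-- Reading each position back shows that different subpatterns have different variables. `meta 0` is
-- excluded because its variable stands for the key and not for a tree.
NamedIn : List Pattern → Pattern → Set
NamedIn ns (meta zero)  = ⊥
NamedIn ns p@(meta _)   = patternAt ns (position ns p) ≡ p
NamedIn ns leaf         = patternAt ns (position ns leaf) ≡ leaf
NamedIn ns p@(a ∙ b)    = patternAt ns (position ns p) ≡ p × NamedIn ns a × NamedIn ns b

Named : Pattern → Set
Named = NamedIn names

named? : ∀ ns p → Dec (NamedIn ns p)
named? ns (meta zero)      = no λ ()
named? ns p@(meta (suc _)) = ≟-tree ℕ._≟_ _ p
named? ns leaf             = ≟-tree ℕ._≟_ _ leaf
named? ns p@(a ∙ b)        = ≟-tree ℕ._≟_ _ p ×-dec (named? ns a ×-dec named? ns b)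

rules-named? : ∀ ns → Dec (∀ r → NamedIn ns (lhs (rule r)) × NamedIn ns (rhs (rule r)))
rules-named? ns = Fin.all? λ r → named? ns (lhs (rule r)) ×-dec named? ns (rhs (rule r))

opaque
  unfolding rule names

  rules-named : ∀ r → Named (lhs (rule r)) × Named (rhs (rule r))
  rules-named = from-yes (rules-named? names)

  accepting-named : Named accepting
  accepting-named = from-yes (named? names accepting)

  token-name : ∀ b → name (numeral (toℕ {4} b)) ≡ toℕ b
  token-name 0F = refl
  token-name 1F = refl
  token-name 2F = refl
  token-name 3F = refl

  tokens-named : Named (numeral 3)
  tokens-named = from-yes (named? names (numeral 3))

  key-named : patternAt names key ≡ meta 0
  key-named = refl

  root-named : Named (meta 1)
  root-named = refl

-- Elements of a model that denote trees

assign : {A : Set} → A → List A → ℕ → A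
assign d []       _       = d
assign d (a ∷ as) zero    = a
assign d (a ∷ as) (suc i) = assign d as i

states : ∀ {T T′} → Run T T′ → List Ground
states {T} ε       = T ∷ []
states {T} (_ ◅ r) = T ∷ states r

first∈states : ∀ {T T′} (r : Run T T′) → T ∈ states r
first∈states ε       = here refl
first∈states (_ ◅ r) = here refl

∈states : ∀ {T T′ U} (r : Run T T′) → U ∈ states r →
  U ≡ T′ ⊎ ∃[ q ] ∃[ θ ] (U ≡ inst θ (lhs (rule q)) × inst θ (rhs (rule q)) ∈ states r)
∈states ε              (here eq)   = inj₁ eq
∈states (step q θ ◅ r) (here refl) = inj₂ (q , θ , refl , there (first∈states r))
∈states (step q θ ◅ r) (there U∈)  with ∈states r U∈
... | inj₁ eq                  = inj₁ eq
... | inj₂ (q′ , θ′ , eq , next∈) = inj₂ (q′ , θ′ , eq , there next∈)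

initialFacts⁻ : ∀ {P : Fact → Set} i {fs} bs → All P (initialFacts i fs bs) → All P fs
initialFacts⁻ i []       (_ ∷ _ ∷ hs) = hs
initialFacts⁻ i (b ∷ bs) hs with initialFacts⁻ (suc i) bs hs
... | _ ∷ _ ∷ hs′ = hs′

module Denotation (𝔅 : Structure τ) (axioms : All (Satisfied 𝔅) structural) where

  private
    D : Set
    D = Fin (size 𝔅)

    variable
      x y z l r : D
      T a b : Ground

  Related : Fin 7 → D → D → Set
  Related s x y = rel 𝔅 s (x ∷ y ∷ []) ≡ true

  related? : ∀ s x y → Dec (Related s x y)
  related? s x y = rel 𝔅 s (x ∷ y ∷ []) Bool.≟ true

  eq-refl : Related eqˢ x x
  eq-refl {x} = All.lookup axioms (here refl) (assign x []) []

  eq-trans : Related eqˢ x y → Related eqˢ y z → Related eqˢ x z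
  eq-trans {x} {y} {z} xy yz =
    All.lookup axioms (there (here refl))
      (assign x (x ∷ y ∷ z ∷ [])) (xy ∷ yz ∷ [])

  eq-left : Related eqˢ x y → Related leftˢ x l → Related leftˢ y r → Related eqˢ l r
  eq-left {x} {y} {l} {r} xy xl yr =
    All.lookup axioms (there (there (here refl)))
      (assign x (x ∷ y ∷ l ∷ r ∷ [])) (xy ∷ xl ∷ yr ∷ [])

  eq-right : Related eqˢ x y → Related rightˢ x l → Related rightˢ y r → Related eqˢ l r
  eq-right {x} {y} {l} {r} xy xl yr =
    All.lookup axioms (there (there (there (here refl))))
      (assign x (x ∷ y ∷ l ∷ r ∷ [])) (xy ∷ xl ∷ yr ∷ [])

  eq-leaf-left : Related eqˢ x y → Related leafˢ x x → Related leftˢ y l → ⊥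
  eq-leaf-left {x} {y} {l} xy xx yl =
    All.lookup axioms (there (there (there (there (here refl)))))
      (assign x (x ∷ y ∷ l ∷ [])) (xy ∷ xx ∷ yl ∷ [])

  eq-left-leaf : Related eqˢ x y → Related leafˢ y y → Related leftˢ x l → ⊥
  eq-left-leaf {x} {y} {l} xy yy xl =
    All.lookup axioms (there (there (there (there (there (here refl))))))
      (assign x (x ∷ y ∷ l ∷ [])) (xy ∷ yy ∷ xl ∷ [])

  -- Allowing an `eqˢ` step before the edges at each level makes denotation invariant under `eqˢ` by
  -- transitivity alone. The relation is not functional: `eqˢ` is not symmetric, so an element may
  -- denote several trees.
  Denotes : D → Ground → Set
  Denotes x (meta ())
  Denotes x leaf    = ∃[ y ] (Related eqˢ x y × Related leafˢ y y)
  Denotes x (a ∙ b) = ∃[ y ] (Related eqˢ x y ×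
    (∃[ l ] (Related leftˢ y l × Denotes l a)) × (∃[ r ] (Related rightˢ y r × Denotes r b)))

  denotes? : ∀ x T → Dec (Denotes x T)
  denotes? x (meta ())
  denotes? x leaf    = Fin.any? λ y → related? eqˢ x y ×-dec related? leafˢ y y
  denotes? x (a ∙ b) = Fin.any? λ y → related? eqˢ x y ×-dec
    ((Fin.any? λ l → related? leftˢ y l ×-dec denotes? l a) ×-dec
     (Fin.any? λ r → related? rightˢ y r ×-dec denotes? r b))

  denotes-resp-eq : ∀ T → Related eqˢ x y → Denotes y T → Denotes x T
  denotes-resp-eq (meta ())
  denotes-resp-eq leaf    xy (z , yz , h) = z , eq-trans xy yz , h
  denotes-resp-eq (a ∙ b) xy (z , yz , h) = z , eq-trans xy yz , h

  denotes-left : Denotes x (a ∙ b) → Related leftˢ x l → Denotes l a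
  denotes-left {a = a} (y , xy , (l′ , yl′ , h) , _) xl = denotes-resp-eq a (eq-left xy xl yl′) h

  denotes-right : Denotes x (a ∙ b) → Related rightˢ x r → Denotes r b
  denotes-right {b = b} (y , xy , _ , (r′ , yr′ , h)) xr = denotes-resp-eq b (eq-right xy xr yr′) h

  module _ (w : ℕ → D) where

    Matches : Pattern → Set
    Matches p = All (Holds 𝔅 w) (shape p)

    -- `Matches` follows edges from the element itself, `Denotes` after an `eqˢ` step. The
    -- congruence clauses carry this step down the clashing path, where a leaf then faces a left
    -- edge.
    matches-clash : ∀ {p q θ} → Clash p q → Matches p → Denotes (w (name p)) (inst θ q) → ⊥
    matches-clash leaf-node (lf ∷ []) (y , xy , (l , yl , _) , _) = eq-leaf-left xy lf yl
    matches-clash node-leaf (l ∷ _)   (y , xy , lf)               = eq-left-leaf xy lf l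
    matches-clash (left {a} c) (l ∷ _ ∷ hs) d =
      matches-clash c (All.++⁻ˡ (shape a) hs) (denotes-left d l)
    matches-clash (right {a} c) (_ ∷ r ∷ hs) d =
      matches-clash c (All.++⁻ʳ (shape a) hs) (denotes-right d r)

    denotes-vars : ∀ {θ i} p → Matches p → Denotes (w (name p)) (inst θ p) → Occurs i p →
      Denotes (w (name (meta i))) (θ i)
    denotes-vars (meta i) _ d refl = d
    denotes-vars (a ∙ b) (l ∷ _ ∷ hs) d (inj₁ i∈a) =
      denotes-vars a (All.++⁻ˡ (shape a) hs) (denotes-left d l) i∈a
    denotes-vars (a ∙ b) (_ ∷ r ∷ hs) d (inj₂ i∈b) =
      denotes-vars b (All.++⁻ʳ (shape a) hs) (denotes-right d r) i∈b

    denotes-inst : ∀ {θ p} → (∀ {i} → Occurs i p → Denotes (w (name (meta i))) (θ i)) →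
      ∀ q → VarsIn p q → Matches q → Denotes (w (name q)) (inst θ q)
    denotes-inst h (meta i) i∈p     _         = h i∈p
    denotes-inst h leaf     _       (lf ∷ []) = _ , eq-refl , lf
    denotes-inst h (a ∙ b)  (v , v′) (l ∷ r ∷ hs) = _ , eq-refl ,
      (_ , l , denotes-inst h a v (All.++⁻ˡ (shape a) hs)) ,
      (_ , r , denotes-inst h b v′ (All.++⁻ʳ (shape a) hs))

    module _ {T T′} (run : Run T T′) where

      -- A denoted state cannot be the final one, since `halted` clashes with every left side. It
      -- was therefore rewritten by some rule, and by determinism that rule is `r`; the
      -- metavariables found on the left then show that the right side denotes the next state.
      denotes-next : ∀ r → (∃[ θ ] T′ ≡ inst θ halted) →
        Matches (lhs (rule r)) → Matches (rhs (rule r)) →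
        Any (Denotes (w (name (lhs (rule r))))) (states run) →
        Any (Denotes (w (name (rhs (rule r))))) (states run)
      denotes-next r (θ , T′-halted) m m′ d with U , U∈ , dU ← find d | ∈states run U∈
      ... | inj₁ refl = ⊥-elim (matches-clash {θ = θ} (lhs-not-halted r) m
                          (≡.subst (Denotes _) T′-halted dU))
      ... | inj₂ (r′ , θ′ , refl , next∈) with rules-deterministic r r′
      ...   | inj₂ c    = ⊥-elim (matches-clash {θ = θ′} c m dU)
      ...   | inj₁ refl = lose next∈
        (denotes-inst {p = lhs (rule r)} (denotes-vars (lhs (rule r)) m dU)
          (rhs (rule r)) (rules-varsIn r) m′)

      denotes-accepting : (∃[ q ] ∃[ θ ] (Clash accepting q × T′ ≡ inst θ q)) →
        Matches accepting → Any (Denotes (w (name accepting))) (states run) → ⊥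
      denotes-accepting (q , θ , c , T′≡) m d with U , U∈ , dU ← find d | ∈states run U∈
      ... | inj₁ refl = matches-clash {θ = θ} c m (≡.subst (Denotes _) T′≡ dU)
      ... | inj₂ (r′ , θ′ , refl , _) = matches-clash {θ = θ′} (lhs-not-accepting r′) m dU

    denotes-token : Matches (numeral 3) → ∀ b → Denotes (w (toℕ {4} b)) (numeral (toℕ b))
    denotes-token m@(_ ∷ _ ∷ _ ∷ m₂@(_ ∷ _ ∷ _ ∷ m₁@(_ ∷ _ ∷ _ ∷ m₀))) b =
      ≡.subst (λ i → Denotes (w i) (numeral (toℕ b))) (token-name b) (go b)
      where
      go : ∀ b → Denotes (w (name (numeral (toℕ {4} b)))) (numeral (toℕ b))
      go 0F = denotes-inst {θ = λ _ → leaf} {leaf} (λ ()) (numeral 0) _ m₀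
      go 1F = denotes-inst {θ = λ _ → leaf} {leaf} (λ ()) (numeral 1) _ m₁
      go 2F = denotes-inst {θ = λ _ → leaf} {leaf} (λ ()) (numeral 2) _ m₂
      go 3F = denotes-inst {θ = λ _ → leaf} {leaf} (λ ()) (numeral 3) _ m

    denotes-chain : ∀ i {fs} bs T → (∀ b → Denotes (w (toℕ {4} b)) (numeral (toℕ b))) →
      Denotes (w i) T → All (Holds 𝔅 w) (initialFacts i fs bs) →
      Denotes (w root) (chain bs T ∙ leaf)
    denotes-chain i []       T t d (l ∷ r ∷ _) = _ , eq-refl , (_ , l , d) , (_ , r , t 0F)
    denotes-chain i (b ∷ bs) T t d hs with initialFacts⁻ (suc i) bs hs
    ... | l ∷ r ∷ _ =
      denotes-chain (suc i) bs (numeral (toℕ b) ∙ T) t (_ , eq-refl , (_ , l , t b) , (_ , r , d)) hs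

    denotes-initial : ∀ bs → All (Holds 𝔅 w) (initialFacts base tokenFacts bs) →
      Denotes (w root) (initial bs)
    denotes-initial bs hs with initialFacts⁻ base bs hs
    ... | lf ∷ m = denotes-chain base bs leaf (denotes-token m) (_ , eq-refl , lf) hs

-- Joint embedding when the machine rejects

does-true : {P : Set} (P? : Dec P) → does P? ≡ true → P
does-true (yes p) _ = p

-- Only `stateˢ` relates the two parts, and across them it depends on its first argument alone:
-- every element of the other part is treated like a key, marked or not.
module Union (𝔅 : Bool → Structure τ) (cross : ∀ b → Fin (size (𝔅 b)) → Bool) where

  Element : Set
  Element = Σ[ b ∈ Bool ] Fin (size (𝔅 b))

  side : Element → Bool
  side = proj₁

  locate : Fin (size (𝔅 false) + size (𝔅 true)) → Element
  locate x = [ (false ,_) , (true ,_) ]′ (splitAt (size (𝔅 false)) x)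

  crossing : Fin 7 → ∀ b → Fin (size (𝔅 b)) → Bool
  crossing stateˢ b i = cross b i
  crossing _      b i = false

  relate : Fin 7 → Element → Element → Bool
  relate s (b , i) (b′ , j) with b Bool.≟ b′
  ... | yes refl = rel (𝔅 b) s (i ∷ j ∷ [])
  ... | no  _    = crossing s b i

  union : Structure τ
  union = record
    { size = size (𝔅 false) + size (𝔅 true)
    ; rel  = λ { s (x ∷ y ∷ []) → relate s (locate x) (locate y) }
    }

  relate-same : ∀ s b i j → relate s (b , i) (b , j) ≡ rel (𝔅 b) s (i ∷ j ∷ [])
  relate-same s false i j = refl
  relate-same s true  i j = refl

  relate-cross : ∀ s e e′ → side e ≢ side e′ → relate s e e′ ≡ crossing s (side e) (proj₂ e)
  relate-cross s (b , _) (b′ , _) b≢b′ with b Bool.≟ b′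
  ... | yes refl = ⊥-elim (b≢b′ refl)
  ... | no  _    = refl

  same-side : ∀ s → (∀ b i → crossing s b i ≡ false) → ∀ e e′ → relate s e e′ ≡ true →
    side e ≡ side e′
  same-side s s-local e e′ h = decidable-stable (side e Bool.≟ side e′) λ neq →
    case trans (sym h) (trans (relate-cross s e e′ neq) (s-local _ _)) of λ ()

  embed : ∀ b → 𝔅 b ↪ union
  embed false = record
    { map       = _↑ˡ size (𝔅 true)
    ; injective = Fin.↑ˡ-injective _ _ _
    ; strong    = λ { s (i ∷ j ∷ []) → cong₂ (relate s) (located i) (located j) }
    }
    where
    located : ∀ i → locate (i ↑ˡ size (𝔅 true)) ≡ (false , i)
    located i = cong [ (false ,_) , (true ,_) ]′ (Fin.splitAt-↑ˡ (size (𝔅 false)) i (size (𝔅 true)))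
  embed true = record
    { map       = size (𝔅 false) ↑ʳ_
    ; injective = Fin.↑ʳ-injective _ _ _
    ; strong    = λ { s (i ∷ j ∷ []) → cong₂ (relate s) (located i) (located j) }
    }
    where
    located : ∀ i → locate (size (𝔅 false) ↑ʳ i) ≡ (true , i)
    located i = cong [ (false ,_) , (true ,_) ]′ (Fin.splitAt-↑ʳ (size (𝔅 false)) (size (𝔅 true)) i)

  -- A total map back to one part; elements of the other part go to the arbitrary default `d`.
  restrict : ∀ b → Fin (size (𝔅 b)) → Element → Fin (size (𝔅 b))
  restrict b d (b′ , j) with b′ Bool.≟ b
  ... | yes refl = j
  ... | no  _    = d

  restrict-side : ∀ b d j → restrict b d (b , j) ≡ j
  restrict-side false d j = refl
  restrict-side true  d j = refl

  relate-restrict : ∀ {b} d s e e′ → side e ≡ b → side e′ ≡ b →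
    relate s e e′ ≡ rel (𝔅 b) s (restrict b d e ∷ restrict b d e′ ∷ [])
  relate-restrict d s (b , i) (_ , j) refl refl = trans (relate-same s b i j)
    (cong₂ (λ i j → rel (𝔅 b) s (i ∷ j ∷ [])) (sym (restrict-side b d i)) (sym (restrict-side b d j)))

  relate-state : ∀ {b} d e e′ → side e ≡ b → side e′ ≢ b →
    relate stateˢ e e′ ≡ cross b (restrict b d e)
  relate-state d e@(b , i) e′ refl e′≢b =
    trans (relate-cross stateˢ e e′ (e′≢b ∘ sym)) (cong (cross b) (sym (restrict-side b d i)))

  module _ (w : ℕ → Fin (size union)) where

    sideOf : ℕ → Bool
    sideOf i = side (locate (w i))

    On : Bool → Fact → Set
    On b f = sideOf (first f) ≡ b × sideOf (second f) ≡ b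

    OnHead : Bool → Maybe Fact → Set
    OnHead b h = ∀ {f} → h ≡ just f → On b f

    restricted : ∀ r → ℕ → Fin (size (𝔅 (sideOf r)))
    restricted r i = restrict (sideOf r) (proj₂ (locate (w r))) (locate (w i))

    holds-restricted : ∀ {r f} → On (sideOf r) f → Holds union w f →
      Holds (𝔅 (sideOf r)) (restricted r) f
    holds-restricted (h₁ , h₂) h = trans (sym (relate-restrict _ _ _ _ h₁ h₂)) h

    all-restricted : ∀ {r fs} → All (On (sideOf r)) fs → All (Holds union w) fs →
      All (Holds (𝔅 (sideOf r)) (restricted r)) fs
    all-restricted []       []       = []
    all-restricted (o ∷ os) (h ∷ hs) = holds-restricted o h ∷ all-restricted os hs

    satisfies-connected : ∀ {r} c → Satisfied (𝔅 (sideOf r)) c →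
      All (On (sideOf r)) (body c) → OnHead (sideOf r) (head c) → Satisfies union w c
    satisfies-connected {r} (b ⇒ just f)  sat os o hs =
      trans (relate-restrict _ _ _ _ (proj₁ (o refl)) (proj₂ (o refl)))
            (sat (restricted r) (all-restricted os hs))
    satisfies-connected {r} (b ⇒ nothing) sat os o hs = sat (restricted r) (all-restricted os hs)

    guarded-on : ∀ {r} fs → All (Holds union w) (guarded r fs) → All (On (sideOf r)) (guarded r fs)
    guarded-on []       []                = []
    guarded-on (f ∷ fs) (s ∷ s′ ∷ _ ∷ hs) =
      (refl , i-on) ∷ (refl , j-on) ∷ (i-on , j-on) ∷ guarded-on fs hs
      where
      i-on = sym (same-side sameˢ (λ _ _ → refl) _ _ s)
      j-on = sym (same-side sameˢ (λ _ _ → refl) _ _ s′)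

    -- The guards put `y` and all variables of `fs` on the side of `r`. If the key is there too, the
    -- clause is inherited from that part; otherwise its facts `fs` still hold in the part, and
    -- `apart` has to supply the head.
    satisfies-keyed : ∀ {r y fs f h} → Satisfied (𝔅 (sideOf r)) (keyed r y fs f h) →
      (sideOf key ≡ sideOf r → On (sideOf r) f) →
      (sideOf key ≡ sideOf r → sideOf y ≡ sideOf r → OnHead (sideOf r) h) →
      (sideOf key ≢ sideOf r → sideOf y ≡ sideOf r →
        All (Holds (𝔅 (sideOf r)) (restricted r)) fs → Holds union w f → HoldsHead union w h) →
      Satisfies union w (keyed r y fs f h)
    satisfies-keyed {r} {y} {fs} {f} {h} sat f-on h-on apart hs
      with gs ← All.++⁻ˡ (guarded r fs) hs | s ∷ f✓ ∷ [] ← All.++⁻ʳ (guarded r fs) hs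
      with os ← guarded-on fs gs | y-on ← sym (same-side sameˢ (λ _ _ → refl) _ _ s)
      with sideOf key Bool.≟ sideOf r
    ... | yes key-on = satisfies-connected {r} (keyed r y fs f h) sat
      (All.++⁺ os ((refl , y-on) ∷ f-on key-on ∷ [])) (h-on key-on y-on) hs
    ... | no  key-off = apart key-off y-on (unguarded fs (all-restricted os gs)) f✓

    -- These clauses carry no guards, but their facts link every variable to variable `0` by
    -- relations that never cross.
    satisfies-structural : (∀ b → All (Satisfied (𝔅 b)) structural) →
      All (Satisfies union w) structural
    satisfies-structural sat with sat (sideOf 0)
    ... | r ∷ t ∷ l ∷ ri ∷ ll ∷ ll′ ∷ [] =
        satisfies-connected {0} _ r [] (λ { refl → refl , refl })
      ∷ (λ { hs@(p ∷ q ∷ []) →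
             let 1-on = eq-on 0 1 refl p ; 2-on = eq-on 1 2 1-on q in
             satisfies-connected {0} _ t ((refl , 1-on) ∷ (1-on , 2-on) ∷ [])
               (λ { refl → refl , 2-on }) hs })
      ∷ (λ { hs@(p ∷ q ∷ u ∷ []) →
             let 1-on = eq-on 0 1 refl p ; 2-on = left-on 0 2 refl q ; 3-on = left-on 1 3 1-on u in
             satisfies-connected {0} _ l ((refl , 1-on) ∷ (refl , 2-on) ∷ (1-on , 3-on) ∷ [])
               (λ { refl → 2-on , 3-on }) hs })
      ∷ (λ { hs@(p ∷ q ∷ u ∷ []) →
             let 1-on = eq-on 0 1 refl p ; 2-on = right-on 0 2 refl q ; 3-on = right-on 1 3 1-on u in
             satisfies-connected {0} _ ri ((refl , 1-on) ∷ (refl , 2-on) ∷ (1-on , 3-on) ∷ [])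
               (λ { refl → 2-on , 3-on }) hs })
      ∷ (λ { hs@(p ∷ q ∷ u ∷ []) →
             let 1-on = eq-on 0 1 refl p ; 2-on = left-on 1 2 1-on u in
             satisfies-connected {0} _ ll ((refl , 1-on) ∷ (refl , refl) ∷ (1-on , 2-on) ∷ [])
               (λ ()) hs })
      ∷ (λ { hs@(p ∷ q ∷ u ∷ []) →
             let 1-on = eq-on 0 1 refl p ; 2-on = left-on 0 2 refl u in
             satisfies-connected {0} _ ll′ ((refl , 1-on) ∷ (1-on , 1-on) ∷ (refl , 2-on) ∷ [])
               (λ ()) hs })
      ∷ []
      where
      eq-on : ∀ i j {b} → sideOf i ≡ b → Holds union w (eqˢ ⟨ i , j ⟩) → sideOf j ≡ b
      eq-on i j o h = trans (sym (same-side eqˢ (λ _ _ → refl) _ _ h)) o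
      left-on : ∀ i j {b} → sideOf i ≡ b → Holds union w (leftˢ ⟨ i , j ⟩) → sideOf j ≡ b
      left-on i j o h = trans (sym (same-side leftˢ (λ _ _ → refl) _ _ h)) o
      right-on : ∀ i j {b} → sideOf i ≡ b → Holds union w (rightˢ ⟨ i , j ⟩) → sideOf j ≡ b
      right-on i j o h = trans (sym (same-side rightˢ (λ _ _ → refl) _ _ h)) o

transition∈fixed : ∀ r → transition (rule r) ∈ fixed
transition∈fixed r = there (Membership.∈-++⁺ˡ (Membership.∈-tabulate⁺ {f = transition ∘ rule} r))

module _ (bs : List Token) (𝔅 : Structure τ) (𝔐 : Mod (Φ bs) 𝔅) where

  starts-satisfied : Satisfied 𝔅 (starts (initialFacts base tokenFacts bs))
  starts-satisfied = mod⇒satisfied 𝔅 (top base bs) (implications bs) 𝔐 (here refl) (starts-bounded bs)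

  fixed-satisfied : ∀ {c} → c ∈ fixed → Satisfied 𝔅 c
  fixed-satisfied c∈ = mod⇒satisfied 𝔅 (top base bs) (implications bs) 𝔐 (there c∈)
    (All.lookup (fixed-bounded (top-≥ base bs)) c∈)

  structural-satisfied : All (Satisfied 𝔅) structural
  structural-satisfied = All.tabulate λ c∈ →
    fixed-satisfied (there (Membership.∈-++⁺ʳ (List.tabulate (transition ∘ rule)) c∈))

module Amalgam (bs : List Token) {T : Ground} (run : Run (initial bs) T)
  (T-halted : ∃[ θ ] T ≡ inst θ halted)
  (T-rejecting : ∃[ q ] ∃[ θ ] (Clash accepting q × T ≡ inst θ q))
  (𝔅 : Bool → Structure τ) (𝔐 : ∀ b → Mod (Φ bs) (𝔅 b)) where

  module Den b = Denotation (𝔅 b) (structural-satisfied bs (𝔅 b) (𝔐 b))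

  Visited : ∀ b → Fin (size (𝔅 b)) → Set
  Visited b x = Any (Den.Denotes b x) (states run)

  opaque
    visited : ∀ b → Fin (size (𝔅 b)) → Bool
    visited b x = does (Any.any? (Den.denotes? b x) (states run))

    visited⁺ : ∀ b x → Visited b x → visited b x ≡ true
    visited⁺ b x = dec-true (Any.any? (Den.denotes? b x) (states run))

    visited⁻ : ∀ b x → visited b x ≡ true → Visited b x
    visited⁻ b x = does-true (Any.any? (Den.denotes? b x) (states run))

  open Union 𝔅 visited public

  module _ (w : ℕ → Fin (size union)) where

    state⁺ : ∀ r y → sideOf w key ≢ sideOf w r → sideOf w y ≡ sideOf w r →
      Visited (sideOf w r) (restricted w r y) → Holds union w (reachable y)
    state⁺ r y k y-on v = trans (relate-state _ _ _ y-on k) (visited⁺ _ _ v)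

    state⁻ : ∀ r → sideOf w key ≢ sideOf w r → Holds union w (reachable r) →
      Visited (sideOf w r) (restricted w r r)
    state⁻ r k h = visited⁻ _ _ (trans (sym (relate-state _ _ _ refl k)) h)

    satisfies-starts : Satisfies union w (starts (initialFacts base tokenFacts bs))
    satisfies-starts = satisfies-keyed w
      {r = 0} {root} {initialFacts base tokenFacts bs} {keyˢ ⟨ key , key ⟩} {just (reachable root)}
      (starts-satisfied bs (𝔅 _) (𝔐 _))
      (λ k → k , k) (λ { k y refl → y , k })
      λ k y hs _ → state⁺ 0 root k y (lose (first∈states run)
        (Den.denotes-initial (sideOf w 0) (restricted w 0) bs hs))

    satisfies-acceptance : Satisfies union w acceptance
    satisfies-acceptance = satisfies-keyed w
      {r = p} {p} {shape accepting} {reachable p} {nothing}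
      (fixed-satisfied bs (𝔅 _) (𝔐 _) (here refl))
      (λ k → refl , k) (λ { k y () })
      λ k y hs h → Den.denotes-accepting (sideOf w p) (restricted w p) run T-rejecting hs (state⁻ p k h)
      where
      p : ℕ
      p = name accepting

    satisfies-transition : ∀ r → Satisfies union w (transition (rule r))
    satisfies-transition r = satisfies-keyed w
      {r = p} {q} {shape (lhs (rule r)) ++ shape (rhs (rule r))} {reachable p} {just (reachable q)}
      (fixed-satisfied bs (𝔅 _) (𝔐 _) (transition∈fixed r))
      (λ k → refl , k) (λ { k y refl → y , k })
      λ k y hs h → state⁺ p q k y
        (Den.denotes-next (sideOf w p) (restricted w p) run r T-halted
          (All.++⁻ˡ (shape (lhs (rule r))) hs) (All.++⁻ʳ (shape (lhs (rule r))) hs) (state⁻ p k h))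
      where
      p q : ℕ
      p = name (lhs (rule r))
      q = name (rhs (rule r))

  union-mod : Mod (Φ bs) union
  union-mod = satisfied⇒mod union (top base bs) (implications bs)
    (satisfies-starts ∷ satisfies-acceptance ∷
     All.++⁺ (All.tabulate⁺ {f = transition ∘ rule} (λ r w → satisfies-transition w r))
       (All.tabulate λ c∈ w → All.lookup
         (satisfies-structural w λ b → structural-satisfied bs (𝔅 b) (𝔐 b)) c∈))

jep : ∀ bs {T} → Run (initial bs) T → (∃[ θ ] T ≡ inst θ halted) →
  (∃[ q ] ∃[ θ ] (Clash accepting q × T ≡ inst θ q)) → HasJEP (Φ bs)
jep bs run T-halted T-rejecting 𝔅₁ 𝔅₂ 𝔐₁ 𝔐₂ = union , union-mod , embed false , embed true
  where
  𝔅 : Bool → Structure τ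
  𝔅 false = 𝔅₁
  𝔅 true  = 𝔅₂

  𝔐 : ∀ b → Mod (Φ bs) (𝔅 b)
  𝔐 false = 𝔐₁
  𝔐 true  = 𝔐₂

  open Amalgam bs run T-halted T-rejecting 𝔅 𝔐

-- Failure of joint embedding when the machine accepts

_≟ᵍ_ : (a b : Ground) → Dec (a ≡ b)
_≟ᵍ_ = ≟-tree λ ()

interpret : Bool → Fin 7 → Ground → Ground → Bool
interpret k leafˢ  a       _ = does (a ≟ᵍ leaf)
interpret k keyˢ   _       _ = k
interpret k leftˢ  (a ∙ _) b = does (a ≟ᵍ b)
interpret k leftˢ  _       _ = false
interpret k rightˢ (_ ∙ a) b = does (a ≟ᵍ b)
interpret k rightˢ _       _ = false
interpret k eqˢ    a       b = does (a ≟ᵍ b)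
interpret k stateˢ _       _ = false
interpret k sameˢ  _       _ = true

canonical : Bool → List Ground → Structure τ
canonical k ts = record
  { size = length ts
  ; rel  = λ { s (i ∷ j ∷ []) → interpret k s (lookup ts i) (lookup ts j) }
  }

module _ {k : Bool} where

  interpret-leaf : ∀ {a b} → interpret k leafˢ a b ≡ true → a ≡ leaf
  interpret-leaf = does-true (_ ≟ᵍ _)

  interpret-eq : ∀ {a b} → interpret k eqˢ a b ≡ true → a ≡ b
  interpret-eq = does-true (_ ≟ᵍ _)

  interpret-left : ∀ {a b} → interpret k leftˢ a b ≡ true → ∃[ c ] a ≡ b ∙ c
  interpret-left {a ∙ _} {b} h = _ , cong (_∙ _) (does-true (a ≟ᵍ b) h)

  interpret-right : ∀ {a b} → interpret k rightˢ a b ≡ true → ∃[ c ] a ≡ c ∙ b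
  interpret-right {_ ∙ a} {b} h = _ , cong (_ ∙_) (does-true (a ≟ᵍ b) h)

module _ (k : Bool) (ts : List Ground) where

  canonical-structural : All (Satisfied (canonical k ts)) structural
  canonical-structural =
      (λ w _ → dec-true (at w 0 ≟ᵍ at w 0) refl)
    ∷ (λ { w (p ∷ q ∷ []) →
           dec-true (at w 0 ≟ᵍ at w 2) (trans (at-eq w 0 1 p) (at-eq w 1 2 q)) })
    ∷ (λ { w (p ∷ q ∷ r ∷ []) → dec-true (at w 2 ≟ᵍ at w 3)
           (proj₁ (∙-injective (trans (sym (proj₂ (at-left w 0 2 q)))
             (trans (at-eq w 0 1 p) (proj₂ (at-left w 1 3 r)))))) })
    ∷ (λ { w (p ∷ q ∷ r ∷ []) → dec-true (at w 2 ≟ᵍ at w 3)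
           (proj₂ (∙-injective (trans (sym (proj₂ (at-right w 0 2 q)))
             (trans (at-eq w 0 1 p) (proj₂ (at-right w 1 3 r)))))) })
    ∷ (λ { w (p ∷ q ∷ r ∷ []) → leaf≢∙
           (trans (sym (at-leaf w 0 q)) (trans (at-eq w 0 1 p) (proj₂ (at-left w 1 2 r)))) })
    ∷ (λ { w (p ∷ q ∷ r ∷ []) → leaf≢∙
           (trans (sym (at-leaf w 1 q)) (trans (sym (at-eq w 0 1 p)) (proj₂ (at-left w 0 2 r)))) })
    ∷ []
    where
    at : (ℕ → Fin (length ts)) → ℕ → Ground
    at w i = lookup ts (w i)
    leaf≢∙ : ∀ {a b : Ground} → leaf ≡ a ∙ b → ⊥
    leaf≢∙ ()
    at-leaf : ∀ w i → Holds (canonical k ts) w (leafˢ ⟨ i , i ⟩) → at w i ≡ leaf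
    at-leaf w i = interpret-leaf {k} {at w i} {at w i}
    at-eq : ∀ w i j → Holds (canonical k ts) w (eqˢ ⟨ i , j ⟩) → at w i ≡ at w j
    at-eq w i j = interpret-eq {k}
    at-left : ∀ w i j → Holds (canonical k ts) w (leftˢ ⟨ i , j ⟩) → ∃[ c ] at w i ≡ at w j ∙ c
    at-left w i j = interpret-left {k}
    at-right : ∀ w i j → Holds (canonical k ts) w (rightˢ ⟨ i , j ⟩) → ∃[ c ] at w i ≡ c ∙ at w j
    at-right w i j = interpret-right {k}

  canonical-keyed : ∀ r y fs i h → Satisfied (canonical k ts) (keyed r y fs (reachable i) h)
  canonical-keyed r y fs i h w hs with All.++⁻ʳ (guarded r fs) hs
  ... | _ ∷ () ∷ []

  canonical-mod : ∀ bs → Satisfied (canonical k ts) (starts (initialFacts base tokenFacts bs)) →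
    Mod (Φ bs) (canonical k ts)
  canonical-mod bs sat = satisfied⇒mod (canonical k ts) (top base bs) (implications bs)
    (sat ∷ canonical-keyed (name accepting) (name accepting) (shape accepting) (name accepting) nothing ∷
     All.++⁺ (All.tabulate⁺ {f = transition ∘ rule} λ r → moves (rule r)) canonical-structural)
    where
    moves : ∀ r → Satisfied (canonical k ts) (transition r)
    moves (p ⟶ q) =
      canonical-keyed (name p) (name q) (shape p ++ shape q) (name p) (just (reachable (name q)))

canonical-keyless : ∀ ts bs → Satisfied (canonical false ts) (starts (initialFacts base tokenFacts bs))
canonical-keyless ts bs w hs with All.++⁻ʳ (guarded 0 (initialFacts base tokenFacts bs)) hs
... | _ ∷ () ∷ []

-- The point is a key, but the starting clause also asks for the left edge of `numeral 3`, and a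
-- single leaf has no edges.
canonical-point : ∀ bs → Satisfied (canonical true (leaf ∷ [])) (starts (initialFacts base tokenFacts bs))
canonical-point bs w hs
  with initialFacts⁻ base bs (unguarded (initialFacts base tokenFacts bs)
         (All.++⁻ˡ (guarded 0 (initialFacts base tokenFacts bs)) hs))
... | _ ∷ l ∷ _ = ⊥-elim (no-edge (w (name (numeral 3))) (w (name leaf)) l)
  where
  no-edge : ∀ i j → interpret true leftˢ (lookup (leaf ∷ []) i) (lookup (leaf ∷ []) j) ≡ true → ⊥
  no-edge 0F j ()

-- Trees of bounded depth and the run forced on a joint extension

depth : Ground → ℕ
depth (meta ())
depth leaf    = 0
depth (a ∙ b) = suc (depth a ⊔ depth b)

trees : ℕ → List Ground
trees zero    = leaf ∷ []
trees (suc d) = leaf ∷ cartesianProductWith _∙_ (trees d) (trees d)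

∈trees : ∀ {d} T → depth T ≤ d → T ∈ trees d
∈trees (meta ())
∈trees {zero}  leaf    _       = here refl
∈trees {suc d} leaf    _       = here refl
∈trees {suc d} (a ∙ b) (s≤s h) = there (Membership.∈-cartesianProductWith⁺ _∙_
  (∈trees a (ℕ.m⊔n≤o⇒m≤o _ _ h)) (∈trees b (ℕ.m⊔n≤o⇒n≤o _ _ h)))

depth-left : ∀ {d} a b → depth (a ∙ b) ≤ d → depth a ≤ d
depth-left a b h = ℕ.≤-trans (ℕ.m≤m⊔n _ _) (ℕ.<⇒≤ h)

depth-right : ∀ {d} a b → depth (a ∙ b) ≤ d → depth b ≤ d
depth-right a b h = ℕ.≤-trans (ℕ.m≤n⊔m _ _) (ℕ.<⇒≤ h)

depth-chain : ∀ {d} bs T → depth (chain bs T) ≤ d → depth T ≤ d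
depth-chain []       T h = h
depth-chain (b ∷ bs) T h = depth-right (numeral (toℕ b)) T (depth-chain bs _ h)

prefix : ℕ → List Token → Ground → Ground
prefix zero    _        T = T
prefix (suc j) []       T = T
prefix (suc j) (b ∷ bs) T = prefix j bs (numeral (toℕ b) ∙ T)

bound : ∀ {T T′} → Run T T′ → ℕ
bound {T} ε       = depth T
bound {T} (_ ◅ r) = depth T ⊔ bound r

bound-first : ∀ {T T′} (r : Run T T′) → depth T ≤ bound r
bound-first ε       = ℕ.≤-refl
bound-first (_ ◅ r) = ℕ.m≤m⊔n _ _

numeral-named : ∀ b → Named (numeral (toℕ {4} b))
numeral-named 3F = tokens-named
numeral-named 2F = proj₂ (proj₂ tokens-named)
numeral-named 1F = proj₂ (proj₂ (proj₂ (proj₂ tokens-named)))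
numeral-named 0F = proj₁ (proj₂ tokens-named)

-- `ℭ` is any common extension. The embeddings import the edges and `sameˢ` from the trees and
-- `keyˢ` from the point; the clauses then force `stateˢ` between a tree and the key, one step of
-- the run after another.
module Simulation (bs : List Token) (d : ℕ) (ℭ : Structure τ) (𝔐 : Mod (Φ bs) ℭ)
  (nodes : canonical false (trees d) ↪ ℭ) (point : canonical true (leaf ∷ []) ↪ ℭ) where

  opaque
    node : Ground → Fin (length (trees d))
    node T with depth T ℕ.≤? d
    ... | yes T≤d = index (∈trees T T≤d)
    -- An arbitrary value for trees that are too deep makes `⟪_⟫` total, so that `Agrees` can speak
    -- of all named patterns at once.
    ... | no  _   = index (∈trees {d} leaf z≤n)

    lookup-node : ∀ {T} → depth T ≤ d → lookup (trees d) (node T) ≡ T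
    lookup-node {T} T≤d with depth T ℕ.≤? d
    ... | yes T≤d′ = sym (lookup-index (∈trees T T≤d′))
    ... | no  T≰d  = ⊥-elim (T≰d T≤d)

  ⟪_⟫ : Ground → Fin (size ℭ)
  ⟪ T ⟫ = _↪_.map nodes (node T)

  κ : Fin (size ℭ)
  κ = _↪_.map point 0F

  rel-node : ∀ s {a b} → depth a ≤ d → depth b ≤ d → interpret false s a b ≡ true →
    rel ℭ s (⟪ a ⟫ ∷ ⟪ b ⟫ ∷ []) ≡ true
  rel-node s {a} {b} a≤d b≤d h = trans (_↪_.strong nodes s (node a ∷ node b ∷ []))
    (trans (cong₂ (interpret false s) (lookup-node a≤d) (lookup-node b≤d)) h)

  rel-same : ∀ a b → rel ℭ sameˢ (⟪ a ⟫ ∷ ⟪ b ⟫ ∷ []) ≡ true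
  rel-same a b = _↪_.strong nodes sameˢ (node a ∷ node b ∷ [])

  rel-key : rel ℭ keyˢ (κ ∷ κ ∷ []) ≡ true
  rel-key = _↪_.strong point keyˢ (0F ∷ 0F ∷ [])

  State : Ground → Set
  State T = rel ℭ stateˢ (⟪ T ⟫ ∷ κ ∷ []) ≡ true

  module _ (w : ℕ → Fin (size ℭ)) where

    Node : ℕ → Ground → Set
    Node i T = w i ≡ ⟪ T ⟫ × depth T ≤ d

    Good : Fact → Set
    Good f = (∃[ a ] Node (first f) a) × (∃[ b ] Node (second f) b) × Holds ℭ w f

    good : ∀ s {i j a b} → Node i a → Node j b → interpret false s a b ≡ true → Good (s ⟨ i , j ⟩)
    good s (i≡ , a≤d) (j≡ , b≤d) h = (_ , i≡ , a≤d) , (_ , j≡ , b≤d) ,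
      trans (cong₂ (λ x y → rel ℭ s (x ∷ y ∷ [])) i≡ j≡) (rel-node s a≤d b≤d h)

    guarded-holds : ∀ {r T} fs → Node r T → All Good fs → All (Holds ℭ w) (guarded r fs)
    guarded-holds []       _ []       = []
    guarded-holds (f ∷ fs) n@(r≡ , _) (((a , i≡ , _) , (b , j≡ , _) , h) ∷ hs) =
      trans (cong₂ (λ x y → rel ℭ sameˢ (x ∷ y ∷ [])) r≡ i≡) (rel-same _ a) ∷
      trans (cong₂ (λ x y → rel ℭ sameˢ (x ∷ y ∷ [])) r≡ j≡) (rel-same _ b) ∷
      h ∷ guarded-holds fs n hs

    keyed-body : ∀ {r y fs f T U} → Node r T → Node y U → All Good fs → Holds ℭ w f →
      All (Holds ℭ w) (guarded r fs ++ sameˢ ⟨ r , y ⟩ ∷ f ∷ [])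
    keyed-body {fs = fs} n@(r≡ , _) (y≡ , _) gs f✓ = All.++⁺ (guarded-holds fs n gs)
      (trans (cong₂ (λ x y → rel ℭ sameˢ (x ∷ y ∷ [])) r≡ y≡) (rel-same _ _) ∷ f✓ ∷ [])

    state⁺ : ∀ {i T} → w key ≡ κ → Node i T → State T → Holds ℭ w (reachable i)
    state⁺ k (i≡ , _) h = trans (cong₂ (λ x y → rel ℭ stateˢ (x ∷ y ∷ [])) i≡ k) h

    state⁻ : ∀ {i T} → w key ≡ κ → Node i T → Holds ℭ w (reachable i) → State T
    state⁻ k (i≡ , _) h = trans (sym (cong₂ (λ x y → rel ℭ stateˢ (x ∷ y ∷ [])) i≡ k)) h

    Agrees : (ℕ → Ground) → Set
    Agrees θ = ∀ p → Named p → w (name p) ≡ ⟪ inst θ p ⟫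

    shape-good : ∀ {θ} → Agrees θ → ∀ p → Named p → depth (inst θ p) ≤ d → All Good (shape p)
    shape-good ag (meta i) _ _ = []
    shape-good ag leaf     n h = good leafˢ (ag leaf n , h) (ag leaf n , h) refl ∷ []
    shape-good {θ} ag (a ∙ b) n@(_ , na , nb) h =
      good leftˢ  (ag (a ∙ b) n , h) (ag a na , ha) (dec-true (inst θ a ≟ᵍ inst θ a) refl) ∷
      good rightˢ (ag (a ∙ b) n , h) (ag b nb , hb) (dec-true (inst θ b ≟ᵍ inst θ b) refl) ∷
      All.++⁺ (shape-good ag a na ha) (shape-good ag b nb hb)
      where
      ha = depth-left (inst θ a) (inst θ b) h
      hb = depth-right (inst θ a) (inst θ b) h

    initialFacts-good : ∀ i {fs} bs T → (∀ j → w (i + j) ≡ ⟪ prefix j bs T ⟫) →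
      Node root (chain bs T ∙ leaf) → (∀ b → w (toℕ {4} b) ≡ ⟪ numeral (toℕ b) ⟫) →
      All Good fs → All Good (initialFacts i fs bs)
    initialFacts-good i [] T ws r@(_ , h) t gs =
      good leftˢ  r (trans (cong w (sym (ℕ.+-identityʳ i))) (ws 0) , depth-left T leaf h)
        (dec-true (T ≟ᵍ T) refl) ∷
      good rightˢ r (t 0F , z≤n) refl ∷ gs
    initialFacts-good i (b ∷ bs) T ws r@(_ , h) t gs =
      initialFacts-good (suc i) bs (numeral (toℕ b) ∙ T)
        (λ j → trans (cong w (sym (ℕ.+-suc i j))) (ws (suc j))) r t
        (good leftˢ si (t b , depth-left U T h′) (dec-true (U ≟ᵍ U) refl) ∷
         good rightˢ si (trans (cong w (sym (ℕ.+-identityʳ i))) (ws 0) , depth-right U T h′)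
           (dec-true (T ≟ᵍ T) refl) ∷ gs)
      where
      U : Ground
      U = numeral (toℕ b)
      h′ : depth (U ∙ T) ≤ d
      h′ = depth-chain bs _ (depth-left (chain bs (U ∙ T)) leaf h)
      si : Node (suc i) (U ∙ T)
      si = trans (cong w (ℕ.+-comm 1 i)) (ws 1) , h′

  value : (ℕ → Ground) → Pattern → Fin (size ℭ)
  value θ (meta zero)      = κ
  value θ p@(meta (suc _)) = ⟪ inst θ p ⟫
  value θ leaf             = ⟪ leaf ⟫
  value θ p@(_ ∙ _)        = ⟪ inst θ p ⟫

  valuation : (ℕ → Ground) → ℕ → Fin (size ℭ)
  valuation θ i = value θ (patternAt names i)

  valuation-agrees : ∀ θ → Agrees (valuation θ) θ
  valuation-agrees θ (meta (suc i)) n       = cong (value θ) n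
  valuation-agrees θ leaf           n       = cong (value θ) n
  valuation-agrees θ (a ∙ b)        (n , _) = cong (value θ) n

  valuation-key : ∀ θ → valuation θ key ≡ κ
  valuation-key θ = cong (value θ) key-named

  state-step : ∀ {T T′} → Step T T′ → depth T ≤ d → depth T′ ≤ d → State T → State T′
  state-step (step r θ) T≤d T′≤d h =
    state⁻ w k q-node (fixed-satisfied bs ℭ 𝔐 (transition∈fixed r) w
      (keyed-body w p-node q-node
        (All.++⁺ (shape-good w ag p (proj₁ (rules-named r)) T≤d)
                 (shape-good w ag q (proj₂ (rules-named r)) T′≤d))
        (state⁺ w k p-node h)))
    where
    p q : Pattern
    p = lhs (rule r)
    q = rhs (rule r)
    w = valuation θ
    ag = valuation-agrees θ
    k = valuation-key θ
    p-node : Node w (name p) (inst θ p)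
    p-node = ag p (proj₁ (rules-named r)) , T≤d
    q-node : Node w (name q) (inst θ q)
    q-node = ag q (proj₂ (rules-named r)) , T′≤d

  state-run : ∀ {T T′} (r : Run T T′) → bound r ≤ d → State T → State T′
  state-run ε       _ h = h
  state-run (s ◅ r) b h = state-run r (ℕ.m⊔n≤o⇒n≤o _ _ b)
    (state-step s (ℕ.m⊔n≤o⇒m≤o _ _ b) (ℕ.≤-trans (bound-first r) (ℕ.m⊔n≤o⇒n≤o _ _ b)) h)

  state-accepting : ∀ θ → depth (inst θ accepting) ≤ d → ¬ State (inst θ accepting)
  state-accepting θ T≤d h =
    fixed-satisfied bs ℭ 𝔐 {acceptance} (here refl) w
      (keyed-body w p-node p-node (shape-good w (valuation-agrees θ) accepting accepting-named T≤d)
        (state⁺ w (valuation-key θ) p-node h))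
    where
    w = valuation θ
    p-node : Node w (name accepting) (inst θ accepting)
    p-node = valuation-agrees θ accepting accepting-named , T≤d

  state-initial′ : ∀ (w : ℕ → Fin (size ℭ)) → Agrees w (λ _ → initial bs) → w key ≡ κ →
    (∀ j → w (base + j) ≡ ⟪ prefix j bs leaf ⟫) →
    3 ≤ d → depth (initial bs) ≤ d → State (initial bs)
  state-initial′ w ag k w-chain 3≤d T≤d =
    state⁻ w k root-node (starts-satisfied bs ℭ 𝔐 w
      (keyed-body w (t 0F , z≤n) root-node
        (initialFacts-good w base bs leaf w-chain root-node t
          (good w leafˢ base-node base-node refl ∷ shape-good w ag (numeral 3) tokens-named 3≤d))
        (trans (cong₂ (λ x y → rel ℭ keyˢ (x ∷ y ∷ [])) k k) rel-key)))
    where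
    inst-numeral : ∀ i → inst (λ _ → initial bs) (numeral i) ≡ numeral i
    inst-numeral zero    = refl
    inst-numeral (suc i) = cong (leaf ∙_) (inst-numeral i)

    t : ∀ b → w (toℕ {4} b) ≡ ⟪ numeral (toℕ b) ⟫
    t b = trans (cong w (sym (token-name b)))
      (trans (ag (numeral (toℕ b)) (numeral-named b)) (cong ⟪_⟫ (inst-numeral (toℕ b))))

    root-node : Node w root (initial bs)
    root-node = ag (meta 1) root-named , T≤d

    base-node : Node w base leaf
    base-node = trans (cong w (sym (ℕ.+-identityʳ base))) (w-chain 0) , z≤n

  state-initial : 3 ≤ d → depth (initial bs) ≤ d → State (initial bs)
  state-initial = state-initial′ w
    (λ p n → trans (w-name (name<base p)) (valuation-agrees θ p n))
    (trans (w-name (name<base (meta 0))) (valuation-key θ)) w-chain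
    where
    θ : ℕ → Ground
    -- `root` is the variable of `meta 1`, so this instance sends it to the initial tree. The other
    -- variables used by the starting clause are tokens, the key and the chain above `base`.
    θ _ = initial bs

    w : ℕ → Fin (size ℭ)
    w i with i ℕ.<? base
    ... | yes _ = valuation θ i
    ... | no  _ = ⟪ prefix (i ∸ base) bs leaf ⟫

    w-name : ∀ {i} → i < base → w i ≡ valuation θ i
    w-name {i} i<b with i ℕ.<? base
    ... | yes _   = refl
    ... | no  i≮b = ⊥-elim (i≮b i<b)

    w-chain : ∀ j → w (base + j) ≡ ⟪ prefix j bs leaf ⟫
    w-chain j with base + j ℕ.<? base
    ... | yes h = ⊥-elim (ℕ.m+n≮m base j h)
    ... | no  _ = cong (λ i → ⟪ prefix i bs leaf ⟫) (ℕ.m+n∸m≡n base j)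

¬jep : ∀ bs {θ} → Run (initial bs) (inst θ accepting) → ¬ HasJEP (Φ bs)
¬jep bs {θ} r h
  -- The summand 3 is the depth of `numeral 3`, the deepest token, whose node the starting clause
  -- requires.
  with ℭ , 𝔐 , nodes , point ← h (canonical false (trees (3 + bound r))) (canonical true (leaf ∷ []))
         (canonical-mod _ _ bs (canonical-keyless _ bs)) (canonical-mod _ _ bs (canonical-point bs)) =
  state-accepting θ (ℕ.≤-trans (bound-last r) b≤) (state-run r b≤ (state-initial (ℕ.m≤m+n 3 _)
    (ℕ.≤-trans (bound-first r) b≤)))
  where
  open Simulation bs (3 + bound r) ℭ 𝔐 nodes point
  b≤ : bound r ≤ 3 + bound r
  b≤ = ℕ.m≤n+m _ 3
  bound-last : ∀ {T T′} (r : Run T T′) → depth T′ ≤ bound r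
  bound-last ε       = ℕ.≤-refl
  bound-last (_ ◅ r) = ℕ.≤-trans (bound-last r) (ℕ.m≤n⊔m _ _)

-- Computing the code of the sentence

encodeFact : Fact → Λ n
encodeFact (s ⟨ i , j ⟩) = encodePair (encodeℕ (toℕ s)) (encodeList encodeℕ (i ∷ j ∷ []))

encodeSigned : Bool × Fact → Λ n
encodeSigned (b , f) = encodePair (encodeBool b) (encodeFact f)

encodeSignedList : List (Bool × Fact) → Λ n
encodeSignedList = encodeList encodeSigned

encodeRaw : List ℕ → ℕ → List (List (Bool × Fact)) → Λ n
encodeRaw as k cs =
  encodePair (encodeList encodeℕ as) (encodePair (encodeℕ k) (encodeList encodeSignedList cs))

encodeList-map : {enc : ∀ {n} → A → Λ n} {enc′ : ∀ {n} → B → Λ n} (f : B → A) → ∀ {xs} →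
  All (λ x → ∀ n → enc {n} (f x) ≡ enc′ {n} x) xs →
  ∀ n → encodeList enc {n} (List.map f xs) ≡ encodeList enc′ {n} xs
encodeList-map f []       n = refl
encodeList-map f (h ∷ hs) n =
  cong₂ (λ x xs → lam (lam (app (app (var zero) x) xs))) (h _) (encodeList-map f hs _)

encodeLiteral-literalAt : ∀ {k} b f → Within k f → ∀ n →
  encodeLiteral {n = n} (literalAt k (b , f)) ≡ encodeSigned (b , f)
encodeLiteral-literalAt false f (h₁ , h₂) n rewrite toℕ-fin h₁ | toℕ-fin h₂ = refl
encodeLiteral-literalAt true  f (h₁ , h₂) n rewrite toℕ-fin h₁ | toℕ-fin h₂ = refl

signed-within : ∀ {k c} → Bounded k c → All (λ (_ , f) → Within k f) (signed c)
signed-within {c = b ⇒ just f}  (bounded b≤ h≤) = All.++⁺ (All.map⁺ b≤) (h≤ refl ∷ [])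
signed-within {c = b ⇒ nothing} (bounded b≤ h≤) = All.++⁺ (All.map⁺ b≤) []

encode-sentence : ∀ k cs → All (Bounded k) cs →
  encodeSentence {n} (sentence k cs) ≡ encodeRaw (List.tabulate (arity τ)) (suc k) (List.map signed cs)
encode-sentence {n} k cs bds =
  cong (λ t → encodePair (encodeList encodeℕ (List.tabulate (arity τ)))
                (encodePair (encodeℕ (suc k)) t))
    (trans (encodeList-map {enc′ = λ c → encodeSignedList (signed c)} (literals k)
              (All.map (λ bd → encodeList-map (literalAt k)
                 (All.map (λ {(b , f)} → encodeLiteral-literalAt b f) (signed-within bd))) bds) _)
           (sym (encodeList-map signed (All.universal (λ _ _ → refl) cs) _)))

-- Codes are closed but occur under any number of binders, so each is a family over `n`; on a stable
-- family substitution only changes the index.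
Stable : (∀ n → Λ n) → Set
Stable c = ∀ {m n} (σ : Fin m → Λ n) → subst σ (c m) ≡ c n

stable-ℕ : ∀ k → Stable (λ n → encodeℕ {n} k)
stable-ℕ zero    σ = refl
stable-ℕ (suc k) σ = cong (λ t → lam (lam (app (var zero) t))) (stable-ℕ k _)

stable-bool : ∀ b → Stable (λ n → encodeBool {n} b)
stable-bool true  σ = refl
stable-bool false σ = refl

stable-pair : ∀ {c d} → Stable c → Stable d → Stable (λ n → encodePair (c (suc n)) (d (suc n)))
stable-pair sc sd σ = cong₂ (λ s t → lam (app (app (var zero) s) t)) (sc _) (sd _)

stable-list : {enc : ∀ {n} → A → Λ n} → (∀ x → Stable (λ n → enc {n} x)) →
  ∀ xs → Stable (λ n → encodeList enc {n} xs)
stable-list h []       σ = refl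
stable-list h (x ∷ xs) σ =
  cong₂ (λ x xs → lam (lam (app (app (var zero) x) xs))) (h x _) (stable-list h xs _)

stable-signed : ∀ f → Stable (λ n → encodeSigned {n} f)
stable-signed (b , s ⟨ i , j ⟩) =
  stable-pair (stable-bool b) (stable-pair (stable-ℕ (toℕ s)) (stable-list stable-ℕ (i ∷ j ∷ [])))

stable-signedList : ∀ fs → Stable (λ n → encodeSignedList {n} fs)
stable-signedList = stable-list stable-signed

stable-rename : ∀ {c} → Stable c → (ρ : Fin m → Fin n) → rename ρ (c m) ≡ c n
stable-rename sc ρ = trans (rename-as-subst (λ _ → refl) _) (sc _)

-- A term over n variables that can be placed under any number m of further
-- binders.
Template : ℕ → Set
Template n = ∀ m → Λ (m + n)

constᵗ : (∀ n → Λ n) → Template n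
constᵗ c m = c _

refᵗ : Fin n → Template n
refᵗ j m = var (m ↑ʳ j)

sucᵗ : Template n → Template n
sucᵗ f m = lam (lam (app (var zero) (f (2 + m))))

pairᵗ consᵗ : Template n → Template n → Template n
pairᵗ f g m = encodePair (f (suc m)) (g (suc m))
consᵗ f g m = lam (lam (app (app (var zero) (f (2 + m))) (g (2 + m))))

extˢ* : ∀ m → (Fin n → Λ o) → Fin (m + n) → Λ (m + o)
extˢ* zero    σ = σ
extˢ* (suc m) σ = extˢ (extˢ* m σ)

infix 4 _⊨_↦_

-- A template headed by an abstraction evaluates at once to a closure whose readback is the
-- substituted template. Data constructors thus cost no computation, and it remains to compare terms
-- under substitution.
record _⊨_↦_ (σ : Fin n → Λ o) (f : Template n) (c : ∀ n → Λ n) : Set where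
  constructor ⟪_⟫
  field
    at : ∀ m → subst (extˢ* m σ) (f m) ≡ c (m + o)

open _⊨_↦_ public

module _ {σ : Fin n → Λ o} where

  ↦-const : ∀ c → Stable c → σ ⊨ constᵗ c ↦ c
  ↦-const c sc = ⟪ (λ m → sc _) ⟫

  ↦-ref : ∀ c {j} → Stable c → σ j ≡ c o → σ ⊨ refᵗ j ↦ c
  ↦-ref c {j} sc eq = ⟪ go ⟫
    where
    go : ∀ m → extˢ* m σ (m ↑ʳ j) ≡ c (m + o)
    go zero    = eq
    go (suc m) = trans (cong (rename suc) (go m)) (stable-rename {c = c} sc suc)

  ↦-suc : ∀ {f} k → σ ⊨ f ↦ (λ _ → encodeℕ k) → σ ⊨ sucᵗ f ↦ (λ _ → encodeℕ (suc k))
  ↦-suc k h = ⟪ (λ m → cong (λ t → lam (lam (app (var zero) t))) (at h (2 + m))) ⟫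

  ↦-pair : ∀ {f g c d} → σ ⊨ f ↦ c → σ ⊨ g ↦ d →
    σ ⊨ pairᵗ f g ↦ (λ n → encodePair (c (suc n)) (d (suc n)))
  ↦-pair h h′ = ⟪ (λ m → cong₂ (λ s t → lam (app (app (var zero) s) t)) (at h (suc m)) (at h′ (suc m))) ⟫

  ↦-cons : ∀ {f g} (enc : ∀ {n} → A → Λ n) x xs →
    σ ⊨ f ↦ (λ _ → enc x) → σ ⊨ g ↦ (λ _ → encodeList enc xs) →
    σ ⊨ consᵗ f g ↦ (λ _ → encodeList enc (x ∷ xs))
  ↦-cons enc x xs h h′ = ⟪ (λ m → cong₂ (λ s t → lam (lam (app (app (var zero) s) t)))
    (at h (2 + m)) (at h′ (2 + m))) ⟫

nilᵗ : Template n
nilᵗ m = lam (lam (var (suc zero)))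

negᵗ : Fin 7 → Template n → Template n → Template n
negᵗ s i j = pairᵗ (constᵗ λ _ → encodeBool false)
  (pairᵗ (constᵗ λ _ → encodeℕ (toℕ s)) (consᵗ i (consᵗ j nilᵗ)))

guardᵗ : Fin 7 → Template n → Template n → Template n → Template n
guardᵗ s i j fs = consᵗ (negᵗ sameˢ 0ᵗ i) (consᵗ (negᵗ sameˢ 0ᵗ j) (consᵗ (negᵗ s i j) fs))
  where 0ᵗ = constᵗ λ _ → encodeℕ 0

guardSigned : Fact → List (Bool × Fact) → List (Bool × Fact)
guardSigned f fs = List.map (false ,_) (guard 0 f) ++ fs

module _ {σ : Fin n → Λ o} where

  ↦-neg : ∀ s k l {i j} → σ ⊨ i ↦ (λ _ → encodeℕ k) → σ ⊨ j ↦ (λ _ → encodeℕ l) →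
    σ ⊨ negᵗ s i j ↦ (λ _ → encodeSigned (false , s ⟨ k , l ⟩))
  ↦-neg s k l h h′ = ↦-pair (↦-const (λ _ → encodeBool false) (stable-bool false))
    (↦-pair (↦-const (λ _ → encodeℕ (toℕ s)) (stable-ℕ (toℕ s)))
      (↦-cons encodeℕ k (l ∷ []) h (↦-cons encodeℕ l [] h′ (⟪_⟫ {f = nilᵗ} (λ _ → refl)))))

  ↦-guard : ∀ s k l fs {i j g} → σ ⊨ i ↦ (λ _ → encodeℕ k) → σ ⊨ j ↦ (λ _ → encodeℕ l) →
    σ ⊨ g ↦ (λ _ → encodeSignedList fs) →
    σ ⊨ guardᵗ s i j g ↦ (λ _ → encodeSignedList (guardSigned (s ⟨ k , l ⟩) fs))
  ↦-guard s k l fs h h′ h″ =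
    ↦-cons encodeSigned (false , sameˢ ⟨ 0 , k ⟩) ((false , sameˢ ⟨ 0 , l ⟩) ∷ (false , s ⟨ k , l ⟩) ∷ fs)
      (↦-neg sameˢ 0 k 0↦ h)
      (↦-cons encodeSigned (false , sameˢ ⟨ 0 , l ⟩) ((false , s ⟨ k , l ⟩) ∷ fs) (↦-neg sameˢ 0 l 0↦ h′)
        (↦-cons encodeSigned (false , s ⟨ k , l ⟩) fs (↦-neg s k l h h′) h″))
    where
    0↦ : σ ⊨ constᵗ (λ _ → encodeℕ 0) ↦ (λ _ → encodeℕ 0)
    0↦ = ↦-const (λ _ → encodeℕ 0) (stable-ℕ 0)

tokensClosure : List Token → Env n → Closure
tokensClosure []       ρ = closure (lam (var (suc zero))) ρ
tokensClosure (b ∷ bs) ρ = closure (lam (app (app (var zero) (encodeℕ (toℕ b))) (encodeTokens bs))) ρ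

tokens⇓ : ∀ bs {ρ : Env n} → ρ ⊢ encodeTokens bs ⇓ tokensClosure bs ρ
tokens⇓ []       = lam⇓
tokens⇓ (b ∷ bs) = lam⇓

lam⇓′ : ∀ {t : Λ n} {s ρ u} → t ≡ lam s → subst (readbackᴱ ρ) t ≡ u →
  ∃[ c ] (ρ ⊢ t ⇓ c × readback c ≡ u)
lam⇓′ refl eq = _ , lam⇓ , eq

encodeℕ⇓ : ∀ k {ρ : Env n} → ∃[ c ] (ρ ⊢ encodeℕ k ⇓ c × readback c ≡ encodeℕ k)
encodeℕ⇓ zero      = lam⇓′ refl refl
encodeℕ⇓ k@(suc _) = lam⇓′ refl (stable-ℕ k _)

signedList⇓ : ∀ fs {ρ : Env n} →
  ∃[ c ] (ρ ⊢ encodeSignedList fs ⇓ c × readback c ≡ encodeSignedList fs)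
signedList⇓ []         = lam⇓′ refl refl
signedList⇓ fs@(_ ∷ _) = lam⇓′ refl (stable-signedList fs _)

-- The λ-term that computes the code and consults the decider

module Program (arities : List ℕ) (clauses : List (List (Bool × Fact))) (root start : ℕ)
  (initial : List (Bool × Fact)) where

  collect : ℕ → List (Bool × Fact) → List Token → List (Bool × Fact)
  collect i fs []       =
    guardSigned (leftˢ ⟨ root , i ⟩) (guardSigned (rightˢ ⟨ root , 0 ⟩) fs)
  collect i fs (b ∷ bs) = collect (suc i)
    (guardSigned (leftˢ ⟨ suc i , toℕ b ⟩) (guardSigned (rightˢ ⟨ suc i , i ⟩) fs)) bs

  -- The free variables of the loop are the remaining tokens, the literals
  -- collected so far, the current variable, the loop itself, and then the
  -- two variables of the program.
  finishᵗ : Template 6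
  finishᵗ = pairᵗ (constᵗ λ _ → encodeList encodeℕ arities)
    (pairᵗ (sucᵗ (refᵗ 2F))
      (consᵗ (guardᵗ leftˢ rootᵗ (refᵗ 2F)
               (guardᵗ rightˢ rootᵗ (constᵗ λ _ → encodeℕ 0) (refᵗ 1F)))
        (constᵗ λ _ → encodeList encodeSignedList clauses)))
    where
    rootᵗ : Template 6
    rootᵗ = constᵗ λ _ → encodeℕ root

  collectᵗ : Template 8
  collectᵗ = guardᵗ leftˢ (sucᵗ (refᵗ 4F)) (refᵗ 1F)
    (guardᵗ rightˢ (sucᵗ (refᵗ 4F)) (refᵗ 4F) (refᵗ 3F))

  continue : Λ 8
  continue = app (app (app (app (var 5F) (var 5F)) (sucᵗ (refᵗ 4F) 0)) (collectᵗ 0)) (var 0F)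

  -- Both branches given to the Scott list are abstractions, so call by value does not run the one
  -- that is not taken. Recursion is by self-application, the loop being one of its own variables.
  loop : Λ 6
  loop = app (app (var 0F) (finishᵗ 0)) (lam (lam continue))

  finish↦ : ∀ {σ : Fin 6 → Λ o} i fs → σ 2F ≡ encodeℕ i → σ 1F ≡ encodeSignedList fs →
    σ ⊨ finishᵗ ↦ (λ _ → encodeRaw arities (suc i) (collect i fs [] ∷ clauses))
  finish↦ {σ = σ} i fs i≡ fs≡ =
    ↦-pair (↦-const (λ _ → encodeList encodeℕ arities) (stable-list stable-ℕ arities))
      (↦-pair (↦-suc i i↦)
        (↦-cons encodeSignedList (collect i fs []) clauses
          (↦-guard leftˢ root i (guardSigned (rightˢ ⟨ root , 0 ⟩) fs) root↦ i↦
            (↦-guard rightˢ root 0 fs root↦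
              (↦-const (λ _ → encodeℕ 0) (stable-ℕ 0))
              (↦-ref (λ _ → encodeSignedList fs) (stable-signedList fs) fs≡)))
          (↦-const (λ _ → encodeList encodeSignedList clauses)
            (stable-list stable-signedList clauses))))
    where
    i↦ : σ ⊨ refᵗ 2F ↦ (λ _ → encodeℕ i)
    i↦ = ↦-ref (λ _ → encodeℕ i) (stable-ℕ i) i≡
    root↦ : σ ⊨ constᵗ (λ _ → encodeℕ root) ↦ (λ _ → encodeℕ root)
    root↦ = ↦-const (λ _ → encodeℕ root) (stable-ℕ root)

  collect↦ : ∀ {σ : Fin 8 → Λ o} i b fs →
    σ 4F ≡ encodeℕ i → σ 1F ≡ encodeℕ b → σ 3F ≡ encodeSignedList fs →
    σ ⊨ sucᵗ (refᵗ 4F) ↦ (λ _ → encodeℕ (suc i)) ×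
    σ ⊨ collectᵗ ↦ (λ _ → encodeSignedList
      (guardSigned (leftˢ ⟨ suc i , b ⟩) (guardSigned (rightˢ ⟨ suc i , i ⟩) fs)))
  collect↦ {σ = σ} i b fs i≡ b≡ fs≡ =
    suc-i↦ ,
    ↦-guard leftˢ (suc i) b (guardSigned (rightˢ ⟨ suc i , i ⟩) fs) suc-i↦
      (↦-ref (λ _ → encodeℕ b) (stable-ℕ b) b≡)
      (↦-guard rightˢ (suc i) i fs suc-i↦ i↦
        (↦-ref (λ _ → encodeSignedList fs) (stable-signedList fs) fs≡))
    where
    i↦ : σ ⊨ refᵗ 4F ↦ (λ _ → encodeℕ i)
    i↦ = ↦-ref (λ _ → encodeℕ i) (stable-ℕ i) i≡
    suc-i↦ : σ ⊨ sucᵗ (refᵗ 4F) ↦ (λ _ → encodeℕ (suc i))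
    suc-i↦ = ↦-suc i i↦

  loop⇓ : ∀ bs {ρ : Env m} {ρ₀ : Env 2} {c d} i fs →
    readback c ≡ encodeℕ i → readback d ≡ encodeSignedList fs →
    ∃[ e ] (tokensClosure bs ρ ∷ d ∷ c ∷ closure (lam (lam (lam loop))) ρ₀ ∷ ρ₀ ⊢ loop ⇓ e ×
            readback e ≡ encodeRaw arities (suc (top i bs)) (collect i fs bs ∷ clauses))
  loop⇓ [] i fs c≡ d≡ =
    _ , app⇓ (app⇓ var⇓ lam⇓ lam⇓) lam⇓ var⇓ , at (finish↦ i fs c≡ d≡) 0
  loop⇓ (b ∷ bs) {ρ} {ρ₀} {c} {d} i fs c≡ d≡ with b′ , b⇓ , b≡ ← encodeℕ⇓ (toℕ b) =
    -- The head of the environment is not read by the templates and is arbitrary.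
    let i↦ , fs↦ = collect↦ {σ = readbackᴱ (b′ ∷ b′ ∷ tokensClosure (b ∷ bs) ρ ∷ d ∷ c ∷
                                            closure (lam (lam (lam loop))) ρ₀ ∷ ρ₀)}
                     i (toℕ b) fs c≡ b≡ d≡
        e , e⇓ , e≡ = loop⇓ bs (suc i)
          (guardSigned (leftˢ ⟨ suc i , toℕ b ⟩) (guardSigned (rightˢ ⟨ suc i , i ⟩) fs))
          (at i↦ 0) (at fs↦ 0)
    in
    e ,
    app⇓ (app⇓ var⇓ lam⇓ lam⇓) lam⇓
      (app⇓ (app⇓ var⇓ b⇓ lam⇓) (tokens⇓ bs)
        (app⇓ (app⇓ (app⇓ (app⇓ var⇓ var⇓ lam⇓) lam⇓ lam⇓) lam⇓ lam⇓) var⇓ e⇓)) ,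
    e≡

  opaque
    compile : Λ 2
    compile = app (app (app (app looper looper) (encodeℕ start)) (encodeSignedList initial)) (var 0F)
      where
      looper : Λ 2
      looper = lam (lam (lam (lam loop)))

    compile⇓ : ∀ bs {ρ : Env m} {c} →
      ∃[ e ] (tokensClosure bs ρ ∷ c ∷ [] ⊢ compile ⇓ e ×
              readback e ≡ encodeRaw arities (suc (top start bs)) (collect start initial bs ∷ clauses))
    compile⇓ bs
      with n , n⇓ , n≡ ← encodeℕ⇓ start | l , l⇓ , l≡ ← signedList⇓ initial
      with e , e⇓ , e≡ ← loop⇓ bs start initial n≡ l≡ =
      e , app⇓ (app⇓ (app⇓ (app⇓ lam⇓ lam⇓ lam⇓) n⇓ lam⇓) l⇓ lam⇓) var⇓ e⇓ , e≡

  identity constant : Λ n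
  identity = lam (var zero)
  constant = lam identity

  -- The answer of `t` is known only up to readback, whereas the machine sees the body of a closure.
  -- A body that is a variable other than `var 0` reads back to an abstraction, so a closure reading
  -- back to `identity` has body `var 0` itself, and one reading back to `constant` never does.
  dispatch : Bool → Λ n
  dispatch true  = identity
  dispatch false = constant

  select : ∀ {n} (ρ : Env n) b f → readback f ≡ encodeBool b →
    ∃[ g ] ((∀ {r} → ρ ⊢ r ⇓ f → ρ ⊢ app (app r identity) constant ⇓ g) ×
            readback g ≡ dispatch b)
  select ρ true (closure _ _) f≡
    with closure _ _ , g⇓ , g≡ ← simulate-β (closure (var zero) ρ) f≡ lam⇓
    with h , h⇓ , h≡ ← simulate-β (closure identity ρ) g≡ lam⇓ =
    h , (λ r⇓ → app⇓ (app⇓ r⇓ lam⇓ g⇓) lam⇓ h⇓) , h≡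
  select ρ false (closure _ _) f≡
    with closure _ _ , g⇓ , g≡ ← simulate-β (closure (var zero) ρ) f≡ lam⇓
    with h , h⇓ , h≡ ← simulate-β (closure identity ρ) g≡ lam⇓ =
    h , (λ r⇓ → app⇓ (app⇓ r⇓ lam⇓ g⇓) lam⇓ h⇓) , h≡

  diagonal : Λ 0 → Λ 0
  diagonal t = app (lam (lam (app (app (app (var 1F) compile) identity) constant))) t

  diagonal⇓ : ∀ bs {t} b →
    app t (encodeRaw arities (suc (top start bs)) (collect start initial bs ∷ clauses)) ⇓ encodeBool b →
    ∃[ c ] ([] ⊢ app (diagonal t) (encodeTokens bs) ⇓ c × readback c ≡ dispatch b)
  diagonal⇓ bs {t} b (app⇓ {s′ = s′} t⇓ lam⇓ b⇓)
    with closure s₁ ρ₁ , t⇓′ , t≡ ← simulate t⇓ t [] (sym (subst-id (λ ()) t))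
    with e , e⇓ , e≡ ← compile⇓ bs {ρ = []} {closure s₁ ρ₁}
    with f , f⇓ , f≡ ← simulate-β e t≡ (≡.subst (λ u → s′ [ u ] ⇓ encodeBool b) (sym e≡) b⇓)
    with g , g⇓ , g≡ ← select _ b f f≡ =
    g , app⇓ (app⇓ lam⇓ t⇓′ lam⇓) (tokens⇓ bs) (g⇓ (app⇓ var⇓ e⇓ f⇓)) , g≡

-- Diagonalization

open Program (List.tabulate (arity τ)) (List.map signed fixed) root base (signed (starts tokenFacts))

collect-starts : ∀ i fs bs → collect i (signed (starts fs)) bs ≡ signed (starts (initialFacts i fs bs))
collect-starts i fs []       = refl
collect-starts i fs (b ∷ bs) = collect-starts (suc i) _ bs

encode-Φ : ∀ bs → encodeSentence {n} (Φ bs) ≡ encodeRaw (List.tabulate (arity τ)) (suc (top base bs))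
  (collect base (signed (starts tokenFacts)) bs ∷ List.map signed fixed)
encode-Φ bs = trans
  (encode-sentence (top base bs) (implications bs) (starts-bounded bs ∷ fixed-bounded (top-≥ base bs)))
  (cong (λ c → encodeRaw (List.tabulate (arity τ)) (suc (top base bs)) (c ∷ List.map signed fixed))
    (sym (collect-starts base tokenFacts bs)))

readback≡identity : ∀ c → readback c ≡ identity → ∃[ ρ ] _≡_ {A = Ground} ⌜ c ⌝ᶜ (varᵗ leaf ∙ ρ)
readback≡identity (closure (var zero)    ρ) _  = _ , refl
readback≡identity (closure (var (suc i)) ρ) eq
  with ρ ‼ i | readbackᴱ-‼ ρ i
... | closure _ _ | eq′ with () ← trans (cong (λ t → lam (rename suc t)) (sym eq′)) eq

-- The outermost constructor of the body, together with the index if it is a variable, already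
-- separates it from `var 0`; the pattern records just this much.
readback≡constant : ∀ c → readback c ≡ constant →
  ∃[ q ] ∃[ θ ] (Clash accepting q × _≡_ {A = Ground} (returning ⌜ c ⌝ᶜ leaf) (inst θ q))
readback≡constant (closure (var (suc i)) ρ) _ =
  returning (varᵗ (leaf ∙ meta 1) ∙ meta 2) leaf , bind (numeral (toℕ i) ∷ ⌜ ρ ⌝ᴱ ∷ []) ,
  right (left (left (right leaf-node))) , refl
readback≡constant (closure (lam s) ρ) _ =
  returning (lamᵗ (meta 1) ∙ meta 2) leaf , bind (⌜ s ⌝ ∷ ⌜ ρ ⌝ᴱ ∷ []) ,
  right (left (left (left leaf-node))) , refl
readback≡constant (closure (app s t) ρ) _ =
  returning (appᵗ (meta 1) (meta 2) ∙ meta 3) leaf , bind (⌜ s ⌝ ∷ ⌜ t ⌝ ∷ ⌜ ρ ⌝ᴱ ∷ []) ,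
  right (left (left (left leaf-node))) , refl

opaque
  program : Λ 0 → List Token
  program t = tokens (diagonal t) []

  run-diagonal : ∀ t b → app t (encodeSentence (Φ (program t))) ⇓ encodeBool b →
    ∃[ c ] (Run (initial (program t)) (returning ⌜ c ⌝ᶜ leaf) × readback c ≡ dispatch b)
  run-diagonal t b t⇓ =
    let c , c⇓ , c≡ = diagonal⇓ (program t) b
          (≡.subst (λ u → app t u ⇓ encodeBool b) (encode-Φ (program t)) t⇓)
    in c , run-program (diagonal t) c⇓ , c≡

true⇒¬jep : ∀ t → app t (encodeSentence (Φ (program t))) ⇓ encodeBool true → ¬ HasJEP (Φ (program t))
true⇒¬jep t t⇓ =
  let c , run , c≡ = run-diagonal t true t⇓
      ρ , eq       = readback≡identity c c≡
  in ¬jep (program t) {bind (ρ ∷ [])}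
       (≡.subst (λ T → Run (initial (program t)) (returning T leaf)) eq run)

false⇒jep : ∀ t → app t (encodeSentence (Φ (program t))) ⇓ encodeBool false → HasJEP (Φ (program t))
false⇒jep t t⇓ =
  let c , run , c≡ = run-diagonal t false t⇓
  in jep (program t) run (bind (⌜ c ⌝ᶜ ∷ []) , refl) (readback≡constant c c≡)

undecidable : Undecidable {Σ HornSentence (ArityAtMost 2)}
    (λ Φ → encodeSentence (proj₁ Φ)) (λ Φ → HasJEP (proj₁ Φ))
-- No case distinction on `HasJEP` is made: the answer true refutes it, and its failure then forces
-- the answer false, which proves it.
undecidable (t , decides) = ¬jepΦ (false⇒jep t (proj₂ (decides instanceΦ) ¬jepΦ))
  where
  instanceΦ : Σ HornSentence (ArityAtMost 2)
  instanceΦ = Φ (program t) , λ _ → ℕ.≤-refl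
  ¬jepΦ : ¬ HasJEP (Φ (program t))
  ¬jepΦ h = true⇒¬jep t (proj₁ (decides instanceΦ) h) h

theorem3 : Undecidable {HornSentence} encodeSentence HasJEP ×
    Undecidable {Σ HornSentence (ArityAtMost 2)}
    (λ Φ → encodeSentence (proj₁ Φ)) (λ Φ → HasJEP (proj₁ Φ))
theorem3 = (λ (t , decides) → undecidable (t , λ (Ψ , _) → decides Ψ)) , undecidable
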